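{- Let $(W,S)$ be a Coxeter system with set of reflections $T$, and let $X\subseteq T$ be an order ideal of the poset $(T,\sqsubseteq)$. Then the poset $(W,\leqslant_{L^X})$ is graded with rank function $\rho:=\ell-\ell\circ Q^{S\cap X}$, i.e. $\rho(w)=\ell(w)-\ell(Q^{S\cap X}(w))$. In other words, $\rho(u)=0$ for every minimal element $u$ of $(W,\leqslant_{L^X})$, and $\rho(v)=\rho(u)+1$ whenever $v$ covers $u$ in $(W,\leqslant_{L^X})$.
   Context: $(W,S)$ is a Coxeter system with finite generating set $S$, length function $\ell$, and set of reflections $T=\{wsw^{ -1}: w\in W,\ s\in S\}$. $\leqslant$ denotes the Bruhat order on $W$ and $<$ its strict version. For $X\subseteq T$, the order $\leqslant_{L^X}$ on $W$ is defined by: $u\leqslant_{L^X} v$ iff $u=v$, or $\ell(u)<\ell(v)$ and there exist $t_1,\dots,t_r\in X$ with $u<t_1u<t_2t_1u<\dots<t_r\cdots t_1u=v$ (all inequalities in the Bruhat order). The Bruhat graph $\Omega_{W,S}$ is the directed graph with vertex set $W$ and an arrow $u\to v$ iff $uv^{ -1}\in T$ and $u<v$. For $Y\subseteq W$, $\Omega_{W,S}(Y)$ is the induced subgraph on $Y$. A reflection subgroup is a subgroup $W'\subseteq W$ generated by a subset of $T$. Such a $W'$ is a Coxeter group with canonical generating set $S'=\{t\in T: N(t)\cap W'=\{t\}\}$, where $N(v)=\{t\in T:\ell(tv)<\ell(v)\}$. $W'$ is called dihedral if $|S'|=2$. Define a relation $\sqsubseteq'$ on $T$ by: $t\sqsubseteq'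 t'$ iff $t=t'$, or there is a dihedral reflection subgroup $W'$ with $t,t'\in W'$ such that the directed distance from $t$ to $t'$ in $\Omega_{W,S}(W')$ is finite. The partial order $\sqsubseteq$ on $T$ is the transitive closure of $\sqsubseteq'$. For $J\subseteq S$, $W_J$ is the subgroup generated by $J$, and ${}^JW=\{w\in W:\ell(w)<\ell(sw)\ \forall s\in J\}$. Every $w\in W$ factors uniquely as $w=w'_J\,{}^Jw$ with $w'_J\in W_J$, ${}^Jw\in{}^JW$ and $\ell(w)=\ell(w'_J)+\ell({}^Jw)$. Set $Q^J(w):={}^Jw$. -}

module Defs where

open import Algebra.Bundles using (Group)
open import Data.Empty using (⊥-elim)
open import Data.Fin using (Fin)
open import Data.List using (List; []; _∷_; _++_; concat; foldr; length; replicate)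
open import Data.Nat using (ℕ; suc; _+_; _∸_; _≤_; _<_)
open import Data.Nat.Properties using (≤-antisym; <-trans; <-asym)
open import Data.Product using (_×_; _,_; ∃-syntax; Σ-syntax)
open import Data.Sum using (_⊎_; inj₁; inj₂)
open import Function.Bundles using (_⇔_)
open import Level using (Level; _⊔_) renaming (suc to lsuc)
open import Relation.Binary.Bundles using (Poset)
open import Relation.Binary.Construct.Closure.Equivalence using (EqClosure)
open import Relation.Binary.Construct.Closure.ReflexiveTransitive using (Star)
open import Relation.Binary.Construct.Closure.Transitive using (TransClosure; [_]; _∷_) renaming (_++_ to _++⁺_)
open import Relation.Binary.Core using (Rel)
open import Relation.Binary.PropositionalEquality using (_≡_; _≢_; refl; sym; subst; subst₂)
open import Relation.Binary.Structures using (IsPartialOrder)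
open import Relation.Nullary using (¬_)
open import Relation.Unary using (Pred; _∈_; _⊆_)
import Relation.Binary.Construct.NonStrictToStrict as ToStrict
import Relation.Binary.Properties.Poset as PosetProperties

module _ {c e r : Level} (P : Poset c e r) where

  open Poset P using (Carrier)
  open PosetProperties P using () renaming (_<_ to _≺_)

  Minimal : Pred Carrier (c ⊔ e ⊔ r)
  Minimal u = ∀ z → ¬ (z ≺ u)

  Covers : Rel Carrier (c ⊔ e ⊔ r)
  Covers v u = u ≺ v × (∀ z → ¬ (u ≺ z × z ≺ v))

  record IsGradedBy (ρ : Carrier → ℕ) : Set (c ⊔ e ⊔ r) where
    field
      minimal-rank : ∀ u → Minimal u → ρ u ≡ 0
      cover-rank   : ∀ u v → Covers v u → ρ v ≡ suc (ρ u)

-- The entry 0 stands for ∞: the corresponding relator (s i s j)⁰ is the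
-- empty word and so imposes no relation.
record CoxeterMatrix (n : ℕ) : Set where
  field
    m           : Fin n → Fin n → ℕ
    symmetric   : ∀ i j → m i j ≡ m j i
    diagonal    : ∀ i → m i i ≡ 1
    offDiagonal : ∀ i j → i ≢ j → m i j ≢ 1

  relator : Fin n → Fin n → List (Fin n)
  relator i j = concat (replicate (m i j) (i ∷ j ∷ []))

  data _⟶_ : Rel (List (Fin n)) Level.zero where
    cancel : ∀ x i j y → (x ++ relator i j ++ y) ⟶ (x ++ y)

  -- The congruence on words generated by the relations (s i s j)^(m i j) = 1.
  -- The relators for i = j are s i s i, so no formal inverses are needed.
  _∼_ : Rel (List (Fin n)) Level.zero
  _∼_ = EqClosure _⟶_

-- A group with generators s i (i : Fin n), presented by the Coxeter relations.
record CoxeterSystem (c e : Level) : Set (lsuc (c ⊔ e)) where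
  field
    group  : Group c e
    n      : ℕ
    matrix : CoxeterMatrix n

  open Group group public
  open CoxeterMatrix matrix public using (m; relator; _∼_)

  field
    s : Fin n → Carrier

  eval : List (Fin n) → Carrier
  eval = foldr (λ i w → s i ∙ w) ε

  field
    generates : ∀ w → ∃[ x ] eval x ≈ w
    relations : ∀ i j → eval (relator i j) ≈ ε
    presented : ∀ x y → eval x ≈ eval y → x ∼ y

-- The (unique) length function; it is given by its defining property because
-- a minimum over the words representing an element is not computable from an
-- arbitrary group setoid.
record LengthFunction {c e : Level} (𝒲 : CoxeterSystem c e) : Set (c ⊔ e) where
  open CoxeterSystem 𝒲
  field
    ℓ        : Carrier → ℕ
    attained : ∀ w → ∃[ x ] (eval x ≈ w × length x ≡ ℓ w)
    minimal  : ∀ w x → eval x ≈ w → ℓ w ≤ length x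

module Coxeter {c e : Level} (𝒲 : CoxeterSystem c e) (len : LengthFunction 𝒲) where

  open CoxeterSystem 𝒲 renaming (refl to ≈-refl; sym to ≈-sym; trans to ≈-trans)
  open LengthFunction len

  T : Pred Carrier (c ⊔ e)
  T t = ∃[ w ] ∃[ i ] t ≈ (w ∙ s i) ∙ w ⁻¹

  BruhatStep : Rel Carrier (c ⊔ e)
  BruhatStep u v = ∃[ t ] (t ∈ T × v ≈ t ∙ u × ℓ u < ℓ v)

  infix 4 _≤ᴮ_ _<ᴮ_

  _≤ᴮ_ : Rel Carrier (c ⊔ e)
  u ≤ᴮ v = u ≈ v ⊎ TransClosure BruhatStep u v

  _<ᴮ_ : Rel Carrier (c ⊔ e)
  _<ᴮ_ = ToStrict._<_ _≈_ _≤ᴮ_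

  data ⟨_⟩ {a : Level} (A : Pred Carrier a) : Pred Carrier (c ⊔ e ⊔ a) where
    incl : ∀ {x} → x ∈ A → x ∈ ⟨ A ⟩
    unit : ε ∈ ⟨ A ⟩
    mult : ∀ {x y} → x ∈ ⟨ A ⟩ → y ∈ ⟨ A ⟩ → (x ∙ y) ∈ ⟨ A ⟩
    inv  : ∀ {x} → x ∈ ⟨ A ⟩ → (x ⁻¹) ∈ ⟨ A ⟩
    resp : ∀ {x y} → x ≈ y → x ∈ ⟨ A ⟩ → y ∈ ⟨ A ⟩

  N : Carrier → Pred Carrier (c ⊔ e)
  N v t = t ∈ T × ℓ (t ∙ v) < ℓ v

  CanonicalGenerator : Pred Carrier (c ⊔ e) → Pred Carrier (c ⊔ e)
  CanonicalGenerator W′ t = t ∈ T × (∀ r → (r ∈ N t × r ∈ W′) ⇔ r ≈ t)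

  IsDihedral : Pred Carrier (c ⊔ e) → Set (c ⊔ e)
  IsDihedral W′ = ∃[ a ] ∃[ b ]
    ( ¬ (a ≈ b)
    × a ∈ CanonicalGenerator W′
    × b ∈ CanonicalGenerator W′
    × (∀ t → t ∈ CanonicalGenerator W′ → t ≈ a ⊎ t ≈ b))

  Arrow : Rel Carrier (c ⊔ e)
  Arrow u v = (u ∙ v ⁻¹) ∈ T × u <ᴮ v

  ArrowIn : Pred Carrier (c ⊔ e) → Rel Carrier (c ⊔ e)
  ArrowIn Y u v = u ∈ Y × v ∈ Y × Arrow u v

  infix 4 _⊑′_ _⊑_

  -- The reflection subgroup W' is ⟨ A ⟩ with A ⊆ T.  The directed distance
  -- from t to t' is finite exactly when there is a directed path from t to t'.
  _⊑′_ : Rel Carrier (lsuc (c ⊔ e))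
  t ⊑′ t′ = t ∈ T × t′ ∈ T ×
    (t ≈ t′ ⊎
     (Σ[ A ∈ Pred Carrier (c ⊔ e) ]
       ( A ⊆ T
       × IsDihedral ⟨ A ⟩
       × t ∈ ⟨ A ⟩
       × t′ ∈ ⟨ A ⟩
       × Star (ArrowIn ⟨ A ⟩) t t′)))

  _⊑_ : Rel Carrier (lsuc (c ⊔ e))
  _⊑_ = TransClosure _⊑′_

  record IsOrderIdeal {p : Level} (X : Pred Carrier p) : Set (lsuc (c ⊔ e) ⊔ p) where
    field
      ⊆T         : X ⊆ T
      downClosed : ∀ {t t′} → t′ ⊑ t → t ∈ X → t′ ∈ X

  S∩ : {p : Level} → Pred Carrier p → Pred (Fin n) p
  S∩ X i = s i ∈ X

  Parabolic : {p : Level} → Pred (Fin n) p → Pred Carrier (c ⊔ e ⊔ p)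
  Parabolic J = ⟨ (λ w → ∃[ i ] (i ∈ J × w ≈ s i)) ⟩

  MinimalCosetRep : {p : Level} → Pred (Fin n) p → Pred Carrier p
  MinimalCosetRep J w = ∀ i → i ∈ J → ℓ w < ℓ (s i ∙ w)

  -- The map Q^J, specified by the (unique) parabolic factorisation of each w.
  record ParabolicProjection {p : Level} (J : Pred (Fin n) p) : Set (c ⊔ e ⊔ p) where
    field
      Q       : Carrier → Carrier
      minRep  : ∀ w → Q w ∈ MinimalCosetRep J
      factors : ∀ w → ∃[ a ] (a ∈ Parabolic J × w ≈ a ∙ Q w × ℓ w ≡ ℓ a + ℓ (Q w))

  -- No truncation occurs: ℓ (Q w) ≤ ℓ w by factors.
  rank : {p : Level} {J : Pred (Fin n) p} → ParabolicProjection J → Carrier → ℕ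
  rank π w = ℓ w ∸ ℓ (ParabolicProjection.Q π w)

  ℓ-cong : ∀ {u v} → u ≈ v → ℓ u ≡ ℓ v
  ℓ-cong {u} {v} u≈v = ≤-antisym (le u≈v) (le (≈-sym u≈v))
    where
    le : ∀ {x y} → x ≈ y → ℓ x ≤ ℓ y
    le {x} {y} x≈y with attained y
    ... | w , ew , lw = subst (ℓ x ≤_) lw (minimal x w (≈-trans ew (≈-sym x≈y)))

  BruhatStep-respˡ : ∀ {u u′ v} → u ≈ u′ → BruhatStep u v → BruhatStep u′ v
  BruhatStep-respˡ q (t , tT , eq , lt) =
    t , tT , ≈-trans eq (∙-congˡ q) , subst₂ _<_ (ℓ-cong q) refl lt

  BruhatStep-respʳ : ∀ {u v v′} → v ≈ v′ → BruhatStep u v → BruhatStep u v′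
  BruhatStep-respʳ q (t , tT , eq , lt) =
    t , tT , ≈-trans (≈-sym q) eq , subst₂ _<_ refl (ℓ-cong q) lt

  ⁺-respˡ : ∀ {r} {R : Rel Carrier r} →
            (∀ {u u′ v} → u ≈ u′ → R u v → R u′ v) →
            ∀ {u u′ v} → u ≈ u′ → TransClosure R u v → TransClosure R u′ v
  ⁺-respˡ f q [ x ]   = [ f q x ]
  ⁺-respˡ f q (x ∷ xs) = f q x ∷ xs

  ⁺-respʳ : ∀ {r} {R : Rel Carrier r} →
            (∀ {u v v′} → v ≈ v′ → R u v → R u v′) →
            ∀ {u v v′} → v ≈ v′ → TransClosure R u v → TransClosure R u v′
  ⁺-respʳ f q [ x ]   = [ f q x ]
  ⁺-respʳ f q (x ∷ xs) = x ∷ ⁺-respʳ f q xs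

  <ᴮ-respˡ : ∀ {u u′ v} → u ≈ u′ → u <ᴮ v → u′ <ᴮ v
  <ᴮ-respˡ q (inj₁ eq , ne) = ⊥-elim (ne eq)
  <ᴮ-respˡ q (inj₂ xs , ne) =
    inj₂ (⁺-respˡ BruhatStep-respˡ q xs) , λ eq → ne (≈-trans q eq)

  <ᴮ-respʳ : ∀ {u v v′} → v ≈ v′ → u <ᴮ v → u <ᴮ v′
  <ᴮ-respʳ q (inj₁ eq , ne) = ⊥-elim (ne eq)
  <ᴮ-respʳ q (inj₂ xs , ne) =
    inj₂ (⁺-respʳ BruhatStep-respʳ q xs) , λ eq → ne (≈-trans eq (≈-sym q))

  module _ {p : Level} (X : Pred Carrier p) where

    LStep : Rel Carrier (c ⊔ e ⊔ p)
    LStep u v = ∃[ t ] (t ∈ X × v ≈ t ∙ u × u <ᴮ v)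

    -- Chains of length r = 0 are excluded by ℓ u < ℓ v.
    LOrder : Rel Carrier (c ⊔ e ⊔ p)
    LOrder u v = u ≈ v ⊎ (ℓ u < ℓ v × TransClosure LStep u v)

    LStep-respˡ : ∀ {u u′ v} → u ≈ u′ → LStep u v → LStep u′ v
    LStep-respˡ q (t , tX , eq , lt) = t , tX , ≈-trans eq (∙-congˡ q) , <ᴮ-respˡ q lt

    LStep-respʳ : ∀ {u v v′} → v ≈ v′ → LStep u v → LStep u v′
    LStep-respʳ q (t , tX , eq , lt) = t , tX , ≈-trans (≈-sym q) eq , <ᴮ-respʳ q lt

    L-trans : ∀ {u v w} → LOrder u v → LOrder v w → LOrder u w
    L-trans (inj₁ p) (inj₁ q) = inj₁ (≈-trans p q)
    L-trans (inj₁ p) (inj₂ (lt , xs)) =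
      inj₂ (subst₂ _<_ (sym (ℓ-cong p)) refl lt , ⁺-respˡ LStep-respˡ (≈-sym p) xs)
    L-trans (inj₂ (lt , xs)) (inj₁ q) =
      inj₂ (subst₂ _<_ refl (ℓ-cong q) lt , ⁺-respʳ LStep-respʳ q xs)
    L-trans (inj₂ (lt , xs)) (inj₂ (lt′ , ys)) = inj₂ (<-trans lt lt′ , xs ++⁺ ys)

    L-antisym : ∀ {u v} → LOrder u v → LOrder v u → u ≈ v
    L-antisym (inj₁ p) _ = p
    L-antisym (inj₂ _) (inj₁ q) = ≈-sym q
    L-antisym (inj₂ (lt , _)) (inj₂ (lt′ , _)) = ⊥-elim (<-asym lt lt′)

    LOrder-isPartialOrder : IsPartialOrder _≈_ LOrder
    LOrder-isPartialOrder = record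
      { isPreorder = record
        { isEquivalence = isEquivalence
        ; reflexive     = inj₁
        ; trans         = L-trans
        }
      ; antisym = L-antisym
      }

    LPoset : Poset c e (c ⊔ e ⊔ p)
    LPoset = record { isPartialOrder = LOrder-isPartialOrder }

{-# OPTIONS --safe #-}
module Submission where

open import Algebra.Bundles using (Group)
import Algebra.Properties.Group as GroupProperties
open import Data.Bool using (Bool; true; false; not; _xor_)
open import Data.Bool.Properties using (xor-assoc; xor-same; xor-identityʳ; not-involutive)
open import Data.Empty using (⊥; ⊥-elim)
open import Data.Fin using (Fin)
open import Data.Fin.Patterns using (0F; 1F; 2F; 3F)
import Data.Fin.Properties as Fin
open import Data.List using (List; []; _∷_; _++_; _∷ʳ_; length; reverse; foldr; concat; replicate)
import Data.List.Properties as List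
open import Data.Maybe using (Maybe; just; nothing)
open import Data.Nat using (ℕ; zero; suc; _+_; _∸_; _≤_; _<_; z≤n; s≤s; s≤s⁻¹)
import Data.Nat.Properties as ℕ
open import Algebra.Properties.CommutativeSemigroup ℕ.+-commutativeSemigroup using (interchange)
open import Data.Product using (Σ; _×_; _,_; proj₁; proj₂; ∃-syntax)
open import Data.Sum using (_⊎_; inj₁; inj₂; [_,_]′)
open import Data.Unit.Polymorphic using (⊤; tt)
open import Data.Vec using (Vec; []; _∷_; lookup)
open import Function.Bundles using (mk⇔; module Equivalence)
open import Level using (Level; _⊔_; Lift; lift)
open import Relation.Binary.Construct.Closure.Equivalence using (gfold)
open import Relation.Binary.Construct.Closure.ReflexiveTransitive using (Star; _◅_; _◅◅_) renaming (ε to done)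
open import Relation.Binary.Construct.Closure.Transitive using (TransClosure; [_]; _∷_) renaming (_++_ to _++⁺_)
open import Relation.Binary.PropositionalEquality using (_≡_; refl; sym; trans; cong; cong₂; subst; subst₂) renaming (isEquivalence to ≡-isEquivalence)
import Relation.Binary.Reasoning.Setoid as SetoidReasoning
open import Relation.Nullary using (¬_; Dec; yes; no; does)
open import Relation.Nullary.Decidable using (map′; dec-true; dec-false; ¬¬-excluded-middle; decidable-stable; _⊎-dec_)
open import Relation.Unary using (Pred; _∈_; _⊆_)
open import Defs

-- Suppose u < t u with t ∈ X and ℓ (t u) ≥ ℓ u + 2; we look for an element of
-- the L^X-interval strictly between.  Stripping right descents of t u off both
-- elements reaches a pair with v < v s < t v s < t v, so that everything takes
-- place in a coset of the reflection subgroup H generated by t and v s v⁻¹.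
-- By Dyer's theorem H is dihedral, with canonical generators a and b, and the
-- coset carries the inversions of H.  As t is neither a nor b, both lie in X,
-- so left weak order moves are available; the only other move needed is by
-- r = v s v⁻¹ or by t r t, one of which lies below t since r ∈ N t.  Hence
-- covers raise ℓ by 1.  Moreover X ⊆ W_J for J = S ∩ X, so ℓ ∘ Q^J is constant
-- along covers.
--
-- No element of X, coset or subgroup can be decided or searched for, so
-- existence is proved under double negation; the conclusions are equalities of
-- natural numbers, hence stable.

-- Inversions are handled by one Boolean cocycle: the parity `η` of a reflection in a word is
-- invariant under the Coxeter relations, so it descends to W, where it tests membership of a
-- reflection in N w. Thus N w is decidable for reflections even though X and H are not, and
-- equality in W is decidable from the length. Descents are stripped on the right because right
-- multiplication leaves t, and with it H, untouched. If x is the shortest element of its coset H x,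
-- a simple reflection s either carries x to x s, again shortest in its coset, or acts on H x as
-- right multiplication of H by a canonical generator. The obstacle is the way back up. The
-- configuration v < v s < t v s < t v is lost when v is already shortest in its coset and the other
-- canonical generator is applied. What replaces it is a pair at least two left weak order steps
-- apart, and that configuration survives all further steps in which both elements ascend. Hence the
-- two constructors of `Shape`.

infixl 7 _⊙_
infix 8 _⁻

-- A solver for group equations.

data Expr (k : ℕ) : Set where
  var : Fin k → Expr k
  one : Expr k
  _⊙_ : Expr k → Expr k → Expr k
  _⁻  : Expr k → Expr k

pattern x₀ = var 0F
pattern x₁ = var 1F
pattern x₂ = var 2F
pattern x₃ = var 3F

-- Decides equations in the free product of copies of ℤ and of ℤ/2: an
-- environment entry may carry a proof that its element is an involution.
module GroupSolver {c e : Level} (G : Group c e) where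

  open Group G renaming (refl to ≈-refl; sym to ≈-sym; trans to ≈-trans)
  open GroupProperties G

  Entry : Set (c ⊔ e)
  Entry = Σ Carrier (λ x → Maybe (x ∙ x ≈ ε))

  free : Carrier → Entry
  free x = x , nothing

  invol : ∀ {x} → x ∙ x ≈ ε → Entry
  invol p = _ , just p

  module _ {k : ℕ} (ρ : Vec Entry k) where

    Literal : Set
    Literal = Fin k × Bool

    ⟦_⟧ : Expr k → Carrier
    ⟦ var i ⟧ = proj₁ (lookup ρ i)
    ⟦ one ⟧   = ε
    ⟦ x ⊙ y ⟧ = ⟦ x ⟧ ∙ ⟦ y ⟧
    ⟦ x ⁻ ⟧   = ⟦ x ⟧ ⁻¹

    signed : Bool → Carrier → Carrier
    signed true  x = x
    signed false x = x ⁻¹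

    value : Literal → Carrier
    value (i , b) = signed b (proj₁ (lookup ρ i))

    values : List Literal → Carrier
    values []       = ε
    values (l ∷ ls) = value l ∙ values ls

    -- Literals of an involution are always made positive, so that two of them meet as a
    -- `true`/`true` pair, the case in which `cancels` consults the environment.
    literal : Fin k → Bool → Literal
    literal i b with lookup ρ i
    ... | _ , just _  = i , true
    ... | _ , nothing = i , b

    literal-value : ∀ i b → value (literal i b) ≈ signed b (proj₁ (lookup ρ i))
    literal-value i b with lookup ρ i in eq
    literal-value i true  | _ , just _ rewrite eq = ≈-refl
    literal-value i false | x , just p rewrite eq = inverseʳ-unique x x p
    literal-value i true  | _ , nothing rewrite eq = ≈-refl
    literal-value i false | _ , nothing rewrite eq = ≈-refl

    cancels : (l m : Literal) → Maybe (value l ∙ value m ≈ ε)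
    cancels (i , b) (j , b′) with i Fin.≟ j
    ... | no _ = nothing
    cancels (i , true)  (.i , false) | yes refl = just (inverseʳ _)
    cancels (i , false) (.i , true)  | yes refl = just (inverseˡ _)
    cancels (i , false) (.i , false) | yes refl = nothing
    cancels (i , true)  (.i , true)  | yes refl = proj₂ (lookup ρ i)

    cons : Literal → List Literal → List Literal
    cons l [] = l ∷ []
    cons l (m ∷ ms) with cancels l m
    ... | just _  = ms
    ... | nothing = l ∷ m ∷ ms

    cons-values : ∀ l ms → values (cons l ms) ≈ value l ∙ values ms
    cons-values l [] = ≈-refl
    cons-values l (m ∷ ms) with cancels l m
    ... | just p  = ≈-sym (≈-trans (≈-sym (assoc _ _ _)) (≈-trans (∙-congʳ p) (identityˡ _)))
    ... | nothing = ≈-refl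

    -- The sign is pushed down to the variables, while `ls` accumulates the normalised part to the
    -- right; cancellation is then only tested at the head.
    norm : Expr k → Bool → List Literal → List Literal
    norm (var i) b ls     = cons (literal i b) ls
    norm one     b ls     = ls
    norm (x ⊙ y) true ls  = norm x true (norm y true ls)
    norm (x ⊙ y) false ls = norm y false (norm x false ls)
    norm (x ⁻)   b ls     = norm x (not b) ls

    signed-not : ∀ b x → signed (not b) x ≈ signed b (x ⁻¹)
    signed-not true  x = ≈-refl
    signed-not false x = ≈-sym (⁻¹-involutive x)

    norm-values : ∀ x b ls → values (norm x b ls) ≈ signed b ⟦ x ⟧ ∙ values ls
    norm-values (var i) b ls = ≈-trans (cons-values _ ls) (∙-congʳ (literal-value i b))
    norm-values one true  ls = ≈-sym (identityˡ _)
    norm-values one false ls = ≈-sym (≈-trans (∙-congʳ ε⁻¹≈ε) (identityˡ _))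
    norm-values (x ⊙ y) true ls =
      ≈-trans (norm-values x true _) (≈-trans (∙-congˡ (norm-values y true ls)) (≈-sym (assoc _ _ _)))
    norm-values (x ⊙ y) false ls =
      ≈-trans (norm-values y false _) (≈-trans (∙-congˡ (norm-values x false ls))
        (≈-trans (≈-sym (assoc _ _ _)) (∙-congʳ (≈-sym (⁻¹-anti-homo-∙ _ _)))))
    norm-values (x ⁻) b ls = ≈-trans (norm-values x (not b) ls) (∙-congʳ (signed-not b _))

    solve : ∀ x y → norm x true [] ≡ norm y true [] → ⟦ x ⟧ ≈ ⟦ y ⟧
    solve x y eq = ≈-trans (≈-sym (sound x)) (≈-trans (≡⇒≈ (cong values eq)) (sound y))
      where
      sound : ∀ x → values (norm x true []) ≈ ⟦ x ⟧
      sound x = ≈-trans (norm-values x true []) (identityʳ _)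
      ≡⇒≈ : ∀ {x y} → x ≡ y → x ≈ y
      ≡⇒≈ refl = ≈-refl

-- Inversion parities of words and their invariance under the Coxeter relations.

module Inversions {c e : Level} (𝒲 : CoxeterSystem c e) (len : LengthFunction 𝒲) where

  open CoxeterSystem 𝒲 public renaming (refl to ≈-refl; sym to ≈-sym; trans to ≈-trans)
  open LengthFunction len public
  open Coxeter 𝒲 len public
  open GroupProperties group public using (x∙y⁻¹≈ε⇒x≈y; x≈y⇒x∙y⁻¹≈ε; inverseʳ-unique; ε⁻¹≈ε)
  open GroupSolver group public
  open SetoidReasoning setoid public
  open CoxeterMatrix matrix using (_⟶_; cancel; diagonal)

  infixl 7.5 _↑_

  _↑_ : Carrier → Carrier → Carrier
  t ↑ x = x ⁻¹ ∙ t ∙ x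

  ↑-cong : ∀ {t t′ x x′} → t ≈ t′ → x ≈ x′ → t ↑ x ≈ t′ ↑ x′
  ↑-cong p q = ∙-cong (∙-cong (⁻¹-cong q) p) q

  ↑-∙ : ∀ t x y → t ↑ x ↑ y ≈ t ↑ (x ∙ y)
  ↑-∙ t x y = solve (free t ∷ free x ∷ free y ∷ [])
    (x₂ ⁻ ⊙ (x₁ ⁻ ⊙ x₀ ⊙ x₁) ⊙ x₂) ((x₁ ⊙ x₂) ⁻ ⊙ x₀ ⊙ (x₁ ⊙ x₂)) refl

  ↑-ε : ∀ t → t ↑ ε ≈ t
  ↑-ε t = solve (free t ∷ []) (one ⁻ ⊙ x₀ ⊙ one) x₀ refl

  ↑-cancel : ∀ t x → t ↑ x ⁻¹ ↑ x ≈ t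
  ↑-cancel t x = solve (free t ∷ free x ∷ []) (x₁ ⁻ ⊙ (x₁ ⁻ ⁻ ⊙ x₀ ⊙ x₁ ⁻) ⊙ x₁) x₀ refl

  ↑-cancel′ : ∀ t x → t ↑ x ↑ x ⁻¹ ≈ t
  ↑-cancel′ t x = solve (free t ∷ free x ∷ []) (x₁ ⁻ ⁻ ⊙ (x₁ ⁻ ⊙ x₀ ⊙ x₁) ⊙ x₁ ⁻) x₀ refl

  ↑-move : ∀ {t x r} → t ↑ x ≈ r → t ≈ r ↑ x ⁻¹
  ↑-move {t} {x} eq = ≈-trans (≈-sym (↑-cancel′ t x)) (↑-cong eq ≈-refl)

  ↑-move′ : ∀ {t x r} → t ↑ x ⁻¹ ≈ r → t ≈ r ↑ x
  ↑-move′ {t} {x} eq = ≈-trans (≈-sym (↑-cancel t x)) (↑-cong eq ≈-refl)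

  s-involutive : ∀ i → s i ∙ s i ≈ ε
  s-involutive i = ≈-trans (∙-congˡ (≈-sym (identityʳ _)))
    (subst (λ k → eval (concat (replicate k (i ∷ i ∷ []))) ≈ ε) (diagonal i) (relations i i))

  eval-++ : ∀ x y → eval (x ++ y) ≈ eval x ∙ eval y
  eval-++ []      y = ≈-sym (identityˡ _)
  eval-++ (i ∷ x) y = ≈-trans (∙-congˡ (eval-++ x y)) (≈-sym (assoc _ _ _))

  infix 4 _≈?_

  -- An element of length 0 is represented by the empty word, so comparing the length of x y⁻¹ with
  -- 0 decides equality in an arbitrary setoid.
  _≈?_ : ∀ x y → Dec (x ≈ y)
  x ≈? y = map′ to from (ℓ (x ∙ y ⁻¹) ℕ.≟ 0)
    where
    to : ℓ (x ∙ y ⁻¹) ≡ 0 → x ≈ y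
    to eq with attained (x ∙ y ⁻¹)
    ... | [] , ev , _ = x∙y⁻¹≈ε⇒x≈y x y (≈-sym ev)
    ... | _ ∷ _ , _ , lw with () ← trans lw eq
    from : x ≈ y → ℓ (x ∙ y ⁻¹) ≡ 0
    from eq = ℕ.n≤0⇒n≡0 (minimal _ [] (≈-sym (x≈y⇒x∙y⁻¹≈ε eq)))

  same : Carrier → Carrier → Bool
  same x y = does (x ≈? y)

  same-false : ∀ {x y} → ¬ x ≈ y → same x y ≡ false
  same-false ne = dec-false (_ ≈? _) ne

  same-true : ∀ {x y} → x ≈ y → same x y ≡ true
  same-true p = dec-true (_ ≈? _) p

  same⇒≈ : ∀ {x y} → same x y ≡ true → x ≈ y
  same⇒≈ {x} {y} eq with x ≈? y
  ... | yes p = p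
  ... | no ¬p with () ← trans (sym eq) (same-false ¬p)

  same-⇔ : ∀ {x y x′ y′} → (x ≈ y → x′ ≈ y′) → (x′ ≈ y′ → x ≈ y) → same x y ≡ same x′ y′
  same-⇔ {x} {y} f g = by (x ≈? y)
    where
    by : Dec (x ≈ y) → _
    by (yes p) = trans (same-true p) (sym (same-true (f p)))
    by (no ¬p) = trans (same-false ¬p) (sym (same-false (λ q → ¬p (g q))))

  -- Parity of the number of positions k of the word x₁ ⋯ xₙ at which
  -- x₁ ⋯ xₖ ⋯ x₁ equals t.
  η : List (Fin n) → Carrier → Bool
  η []      t = false
  η (i ∷ x) t = same t (s i) xor η x (t ↑ s i)

  η-cong : ∀ x {t t′} → t ≈ t′ → η x t ≡ η x t′
  η-cong []      p = refl
  η-cong (i ∷ x) p = cong₂ _xor_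
    (same-⇔ (≈-trans (≈-sym p)) (≈-trans p)) (η-cong x (↑-cong p ≈-refl))

  η-++ : ∀ x y t → η (x ++ y) t ≡ η x t xor η y (t ↑ eval x)
  η-++ []      y t = η-cong y (≈-sym (↑-ε t))
  η-++ (i ∷ x) y t = trans
    (cong (same t (s i) xor_) (trans (η-++ x y _) (cong (η x _ xor_) (η-cong y (↑-∙ t (s i) (eval x))))))
    (sym (xor-assoc (same t (s i)) _ _))

  -- The 2k reflections read off (sᵢ sⱼ)ᵏ are cᵠ sᵢ for q < 2k, where c = sᵢ sⱼ;
  -- for k = m i j each of them occurs twice since cᵐ = 1.
  module Relator (i j : Fin n) where

    c⁻¹ : Carrier
    c⁻¹ = s j ∙ s i

    c⁻^ : ℕ → Carrier
    c⁻^ zero    = ε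
    c⁻^ (suc k) = c⁻^ k ∙ c⁻¹

    word : ℕ → List (Fin n)
    word k = concat (replicate k (i ∷ j ∷ []))

    count : ℕ → Carrier → Bool
    count zero    t = false
    count (suc q) t = same t (s i) xor count q (c⁻¹ ∙ t)

    private
      i² = s-involutive i
      j² = s-involutive j

    count-cong : ∀ q {t t′} → t ≈ t′ → count q t ≡ count q t′
    count-cong zero    p = refl
    count-cong (suc q) p = cong₂ _xor_
      (same-⇔ (≈-trans (≈-sym p)) (≈-trans p)) (count-cong q (∙-congˡ p))

    count-+ : ∀ q r t → count (q + r) t ≡ count q t xor count r (c⁻^ q ∙ t)
    count-+ zero    r t = count-cong r (≈-sym (identityˡ t))
    count-+ (suc q) r t = trans
      (cong (same t (s i) xor_)
        (trans (count-+ q r _) (cong (count q _ xor_) (count-cong r (≈-sym (assoc _ _ _))))))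
      (sym (xor-assoc (same t (s i)) _ _))

    -- Since `s i` inverts c, the conjugate c⁻¹ t c equals `s i` exactly when c⁻² t does: for these
    -- tests, conjugation by c is a shift by two positions.
    count-conj : ∀ q t → count q (t ↑ s i ↑ s j) ≡ count q (c⁻¹ ∙ (c⁻¹ ∙ t))
    count-conj zero    t = refl
    count-conj (suc q) t = cong₂ _xor_ (same-⇔ to from)
      (trans (count-cong q shift) (count-conj q (c⁻¹ ∙ t)))
      where
      shift : c⁻¹ ∙ (t ↑ s i ↑ s j) ≈ (c⁻¹ ∙ t) ↑ s i ↑ s j
      shift = solve (invol i² ∷ invol j² ∷ free t ∷ [])
        (x₁ ⊙ x₀ ⊙ (x₁ ⁻ ⊙ (x₀ ⁻ ⊙ x₂ ⊙ x₀) ⊙ x₁)) (x₁ ⁻ ⊙ (x₀ ⁻ ⊙ (x₁ ⊙ x₀ ⊙ x₂) ⊙ x₀) ⊙ x₁) refl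
      to : t ↑ s i ↑ s j ≈ s i → c⁻¹ ∙ (c⁻¹ ∙ t) ≈ s i
      to p = begin
        c⁻¹ ∙ (c⁻¹ ∙ t) ≈⟨ solve (invol i² ∷ invol j² ∷ free t ∷ [])
          (x₁ ⊙ x₀ ⊙ (x₁ ⊙ x₀ ⊙ x₂)) (x₁ ⊙ x₀ ⊙ (x₁ ⁻ ⊙ (x₀ ⁻ ⊙ x₂ ⊙ x₀) ⊙ x₁) ⊙ x₁ ⊙ x₀) refl ⟩
        c⁻¹ ∙ (t ↑ s i ↑ s j) ∙ s j ∙ s i ≈⟨ ∙-congʳ (∙-congʳ (∙-congˡ p)) ⟩
        c⁻¹ ∙ s i ∙ s j ∙ s i ≈⟨ solve (invol i² ∷ invol j² ∷ []) (x₁ ⊙ x₀ ⊙ x₀ ⊙ x₁ ⊙ x₀) x₀ refl ⟩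
        s i ∎
      from : c⁻¹ ∙ (c⁻¹ ∙ t) ≈ s i → t ↑ s i ↑ s j ≈ s i
      from p = begin
        t ↑ s i ↑ s j ≈⟨ solve (invol i² ∷ invol j² ∷ free t ∷ [])
          (x₁ ⁻ ⊙ (x₀ ⁻ ⊙ x₂ ⊙ x₀) ⊙ x₁) (x₀ ⊙ x₁ ⊙ (x₁ ⊙ x₀ ⊙ (x₁ ⊙ x₀ ⊙ x₂)) ⊙ x₀ ⊙ x₁) refl ⟩
        s i ∙ s j ∙ (c⁻¹ ∙ (c⁻¹ ∙ t)) ∙ s i ∙ s j ≈⟨ ∙-congʳ (∙-congʳ (∙-congˡ p)) ⟩
        s i ∙ s j ∙ s i ∙ s i ∙ s j ≈⟨ solve (invol i² ∷ invol j² ∷ []) (x₀ ⊙ x₁ ⊙ x₀ ⊙ x₀ ⊙ x₁) x₀ refl ⟩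
        s i ∎

    η-word : ∀ k t → η (word k) t ≡ count (k + k) t
    η-word zero    t = refl
    η-word (suc k) t = trans
      (cong (same t (s i) xor_)
        (cong₂ _xor_ (same-⇔ to from) (trans (η-word k _) (count-conj (k + k) t))))
      (sym (cong (λ l → count (suc l) t) (ℕ.+-suc k k)))
      where
      to : t ↑ s i ≈ s j → c⁻¹ ∙ t ≈ s i
      to p = begin
        c⁻¹ ∙ t ≈⟨ solve (invol i² ∷ invol j² ∷ free t ∷ [])
          (x₁ ⊙ x₀ ⊙ x₂) (x₁ ⊙ (x₀ ⁻ ⊙ x₂ ⊙ x₀) ⊙ x₀) refl ⟩
        s j ∙ (t ↑ s i) ∙ s i ≈⟨ ∙-congʳ (∙-congˡ p) ⟩
        s j ∙ s j ∙ s i ≈⟨ solve (invol i² ∷ invol j² ∷ []) (x₁ ⊙ x₁ ⊙ x₀) x₀ refl ⟩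
        s i ∎
      from : c⁻¹ ∙ t ≈ s i → t ↑ s i ≈ s j
      from p = begin
        t ↑ s i ≈⟨ solve (invol i² ∷ invol j² ∷ free t ∷ [])
          (x₀ ⁻ ⊙ x₂ ⊙ x₀) (x₁ ⊙ (x₁ ⊙ x₀ ⊙ x₂) ⊙ x₀) refl ⟩
        s j ∙ (c⁻¹ ∙ t) ∙ s i ≈⟨ ∙-congʳ (∙-congˡ p) ⟩
        s j ∙ s i ∙ s i ≈⟨ solve (invol i² ∷ invol j² ∷ []) (x₁ ⊙ x₀ ⊙ x₀) x₁ refl ⟩
        s j ∎

    c⁻^-eval : ∀ k → c⁻^ k ∙ eval (word k) ≈ ε
    c⁻^-eval zero    = identityˡ ε
    c⁻^-eval (suc k) = ≈-trans
      (solve (invol i² ∷ invol j² ∷ free (c⁻^ k) ∷ free (eval (word k)) ∷ [])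
        (x₂ ⊙ (x₁ ⊙ x₀) ⊙ (x₀ ⊙ (x₁ ⊙ x₃))) (x₂ ⊙ x₃) refl)
      (c⁻^-eval k)

    η-relator : ∀ t → η (relator i j) t ≡ false
    η-relator t = trans (η-word (m i j) t) (trans (count-+ (m i j) (m i j) t)
      (trans (cong (count (m i j) t xor_) (count-cong (m i j) trivial)) (xor-same (count (m i j) t))))
      where
      trivial : c⁻^ (m i j) ∙ t ≈ t
      trivial = ≈-trans (∙-congʳ (≈-trans (≈-sym (identityʳ _))
        (≈-trans (∙-congˡ (≈-sym (relations i j))) (c⁻^-eval (m i j))))) (identityˡ t)

  η-⟶ : ∀ {x y} t → x ⟶ y → η x t ≡ η y t
  η-⟶ t (cancel x i j y) = trans (η-++ x _ t) (trans (cong (η x t xor_) drop) (sym (η-++ x y t)))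
    where
    drop : η (relator i j ++ y) (t ↑ eval x) ≡ η y (t ↑ eval x)
    drop = trans (η-++ (relator i j) y _) (cong₂ _xor_ (Relator.η-relator i j _)
      (η-cong y (≈-trans (↑-cong ≈-refl (relations i j)) (↑-ε _))))

  η-∼ : ∀ {x y} t → x ∼ y → η x t ≡ η y t
  η-∼ t = gfold ≡-isEquivalence (λ x → η x t) (η-⟶ t)

  parity : ∀ {a} {A : Set a} → List A → Bool
  parity []      = false
  parity (_ ∷ x) = not (parity x)

  parity-++ : ∀ {a} {A : Set a} (x y : List A) → parity (x ++ y) ≡ parity x xor parity y
  parity-++ []      y = refl
  parity-++ (_ ∷ x) y with parity x | parity-++ x y
  ... | true  | eq rewrite eq = not-involutive (parity y)
  ... | false | eq rewrite eq = refl

  parity-⟶ : ∀ {x y} → x ⟶ y → parity x ≡ parity y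
  parity-⟶ (cancel x i j y) = trans (parity-++ x _) (trans (cong (parity x xor_)
    (trans (parity-++ (relator i j) y) (cong (_xor parity y) (even (m i j))))) (sym (parity-++ x y)))
    where
    even : ∀ k → parity (Relator.word i j k) ≡ false
    even zero    = refl
    even (suc k) = trans (not-involutive _) (even k)

  parity-∼ : ∀ {x y} → x ∼ y → parity x ≡ parity y
  parity-∼ = gfold ≡-isEquivalence parity parity-⟶

-- The reflection cocycle on W.

module N-cocycle {c e : Level} (𝒲 : CoxeterSystem c e) (len : LengthFunction 𝒲) where

  open Inversions 𝒲 len public

  word : Carrier → List (Fin n)
  word w = proj₁ (generates w)

  -- For a reflection t, ν w t decides t ∈ N w.
  ν : Carrier → Carrier → Bool
  ν w t = η (word w) t

  ν-eval : ∀ x {w} t → eval x ≈ w → ν w t ≡ η x t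
  ν-eval x t ev = η-∼ t (presented (word _) x (≈-trans (proj₂ (generates _)) (≈-sym ev)))

  ν-cong : ∀ {w w′ t t′} → w ≈ w′ → t ≈ t′ → ν w t ≡ ν w′ t′
  ν-cong {w} {w′} p q = trans (ν-eval (word w′) _ (≈-trans (proj₂ (generates w′)) (≈-sym p))) (η-cong (word w′) q)

  ν-congʳ : ∀ {w t t′} → t ≈ t′ → ν w t ≡ ν w t′
  ν-congʳ = ν-cong ≈-refl

  ν-congˡ : ∀ {w w′ t} → w ≈ w′ → ν w t ≡ ν w′ t
  ν-congˡ p = ν-cong p ≈-refl

  -- The cocycle identity N(xy) = N(x) + x N(y) x⁻¹, where + is symmetric difference.
  ν-∙ : ∀ x y t → ν (x ∙ y) t ≡ ν x t xor ν y (t ↑ x)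
  ν-∙ x y t = trans
    (ν-eval (word x ++ word y) t (≈-trans (eval-++ (word x) _) (∙-cong (proj₂ (generates x)) (proj₂ (generates y)))))
    (trans (η-++ (word x) (word y) t)
      (cong (η (word x) t xor_) (η-cong (word y) (↑-cong ≈-refl (proj₂ (generates x))))))

  ν-ε : ∀ t → ν ε t ≡ false
  ν-ε t = ν-eval [] t ≈-refl

  ν-s : ∀ i t → ν (s i) t ≡ same t (s i)
  ν-s i t = trans (ν-eval (i ∷ []) t (identityʳ _)) (xor-identityʳ _)

  xor-false : ∀ {x y} → x xor y ≡ false → x ≡ y
  xor-false {true}  {true}  _ = refl
  xor-false {false} {false} _ = refl

  ν-⁻¹ : ∀ w t → ν (w ⁻¹) t ≡ ν w (t ↑ w ⁻¹)
  ν-⁻¹ w t = sym (xor-false (trans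
    (cong (ν w (t ↑ w ⁻¹) xor_) (ν-congʳ (≈-sym (↑-cancel t w))))
    (trans (sym (ν-∙ w (w ⁻¹) _)) (trans (ν-congˡ (inverseʳ w)) (ν-ε _)))))

  T-resp : ∀ {t t′} → t ≈ t′ → t ∈ T → t′ ∈ T
  T-resp p (w , i , eq) = w , i , ≈-trans (≈-sym p) eq

  s∈T : ∀ i → s i ∈ T
  s∈T i = ε , i , solve (free (s i) ∷ []) x₀ (one ⊙ x₀ ⊙ one ⁻) refl

  T-↑ : ∀ {t} x → t ∈ T → t ↑ x ∈ T
  T-↑ {t} x (w , i , eq) = x ⁻¹ ∙ w , i , ≈-trans (↑-cong eq ≈-refl)
    (solve (free x ∷ free w ∷ free (s i) ∷ [])
      (x₀ ⁻ ⊙ (x₁ ⊙ x₂ ⊙ x₁ ⁻) ⊙ x₀) (x₀ ⁻ ⊙ x₁ ⊙ x₂ ⊙ (x₀ ⁻ ⊙ x₁) ⁻) refl)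

  T-involutive : ∀ {t} → t ∈ T → t ∙ t ≈ ε
  T-involutive (w , i , eq) = ≈-trans (∙-cong eq eq)
    (solve (free w ∷ invol (s-involutive i) ∷ [])
      ((x₀ ⊙ x₁ ⊙ x₀ ⁻) ⊙ (x₀ ⊙ x₁ ⊙ x₀ ⁻)) one refl)

  T-⁻¹ : ∀ {t} → t ∈ T → t ⁻¹ ≈ t
  T-⁻¹ {t} tT = ≈-sym (inverseʳ-unique t t (T-involutive tT))

  ε∉T : ¬ ε ∈ T
  ε∉T (w , i , eq) = contra (trans (sym (trans (ν-congˡ s≈ε) (ν-ε _))) (trans (ν-s i (s i)) (same-true ≈-refl)))
    where
    contra : ¬ false ≡ true
    contra ()
    s≈ε : s i ≈ ε
    s≈ε = begin
      s i                          ≈⟨ solve (free w ∷ free (s i) ∷ []) x₁ (x₀ ⁻ ⊙ (x₀ ⊙ x₁ ⊙ x₀ ⁻) ⊙ x₀) refl ⟩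
      w ⁻¹ ∙ (w ∙ s i ∙ w ⁻¹) ∙ w  ≈⟨ ∙-congʳ (∙-congˡ eq) ⟨
      w ⁻¹ ∙ ε ∙ w                 ≈⟨ solve (free w ∷ []) (x₀ ⁻ ⊙ one ⊙ x₀) one refl ⟩
      ε                            ∎

  -- For t = w s w⁻¹ the contributions of w and w⁻¹ agree and cancel, leaving that of s.
  ν-self : ∀ {t} → t ∈ T → ν t t ≡ true
  ν-self {t} (w , i , eq) = trans (ν-congˡ eq) (trans (ν-∙ (w ∙ s i) (w ⁻¹) t)
    (trans (cong₂ _xor_ (ν-∙ w (s i) t) last)
      (trans (cong (λ b → (ν w t xor b) xor ν w t) (trans (ν-s i _) (same-true middle))) (flip (ν w t)))))
    where
    middle : t ↑ w ≈ s i
    middle = ≈-trans (↑-cong eq ≈-refl)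
      (solve (free w ∷ free (s i) ∷ []) (x₀ ⁻ ⊙ (x₀ ⊙ x₁ ⊙ x₀ ⁻) ⊙ x₀) x₁ refl)
    last : ν (w ⁻¹) (t ↑ (w ∙ s i)) ≡ ν w t
    last = trans (ν-⁻¹ w _) (ν-congʳ (≈-trans (↑-cong (↑-cong eq ≈-refl) ≈-refl)
      (≈-trans (solve (free w ∷ free (s i) ∷ [])
        (x₀ ⁻ ⁻ ⊙ ((x₀ ⊙ x₁) ⁻ ⊙ (x₀ ⊙ x₁ ⊙ x₀ ⁻) ⊙ (x₀ ⊙ x₁)) ⊙ x₀ ⁻) (x₀ ⊙ x₁ ⊙ x₀ ⁻) refl) (≈-sym eq))))
    flip : ∀ b → (b xor true) xor b ≡ true
    flip true  = refl
    flip false = refl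

  record IsSubgroup {a} (H : Pred Carrier a) : Set (c ⊔ e ⊔ a) where
    field
      ε∈   : ε ∈ H
      ∙∈   : ∀ {x y} → x ∈ H → y ∈ H → x ∙ y ∈ H
      ⁻¹∈  : ∀ {x} → x ∈ H → x ⁻¹ ∈ H
      resp∈ : ∀ {x y} → x ≈ y → x ∈ H → y ∈ H

    ↑∈ : ∀ {p x} → x ∈ H → p ∈ H → p ↑ x ∈ H
    ↑∈ xH pH = ∙∈ (∙∈ (⁻¹∈ xH) pH) xH

    ↑⁻¹∈ : ∀ {p x} → x ∈ H → p ∈ H → p ↑ x ⁻¹ ∈ H
    ↑⁻¹∈ xH pH = ↑∈ (⁻¹∈ xH) pH

  ⟨⟩-isSubgroup : ∀ {a} (A : Pred Carrier a) → IsSubgroup ⟨ A ⟩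
  ⟨⟩-isSubgroup A = record { ε∈ = unit ; ∙∈ = mult ; ⁻¹∈ = inv ; resp∈ = resp }

  ⟨⟩-least : ∀ {a h} {A : Pred Carrier a} {H : Pred Carrier h} → IsSubgroup H → A ⊆ H → ⟨ A ⟩ ⊆ H
  ⟨⟩-least H-sub A⊆H (incl xA)   = A⊆H xA
  ⟨⟩-least H-sub A⊆H unit        = IsSubgroup.ε∈ H-sub
  ⟨⟩-least H-sub A⊆H (mult x y)  = IsSubgroup.∙∈ H-sub (⟨⟩-least H-sub A⊆H x) (⟨⟩-least H-sub A⊆H y)
  ⟨⟩-least H-sub A⊆H (inv x)     = IsSubgroup.⁻¹∈ H-sub (⟨⟩-least H-sub A⊆H x)
  ⟨⟩-least H-sub A⊆H (resp eq x) = IsSubgroup.resp∈ H-sub eq (⟨⟩-least H-sub A⊆H x)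

  -- Exchange and reduced words, for simple, dihedral and parabolic generators alike.

  module Words {i h} {I : Set i} (g : I → Carrier) {H : Pred Carrier h} (H-sub : IsSubgroup H)
    (g∈T : ∀ i → g i ∈ T) (g∈H : ∀ i → g i ∈ H)
    (canonical : ∀ i p → p ∈ H → ν (g i) p ≡ true → p ≈ g i) where

    open IsSubgroup H-sub

    ev : List I → Carrier
    ev = foldr (λ i w → g i ∙ w) ε

    ev∈H : ∀ z → ev z ∈ H
    ev∈H []      = ε∈
    ev∈H (i ∷ z) = ∙∈ (g∈H i) (ev∈H z)

    ev-++ : ∀ x y → ev (x ++ y) ≈ ev x ∙ ev y
    ev-++ []      y = ≈-sym (identityˡ _)
    ev-++ (i ∷ x) y = ≈-trans (∙-congˡ (ev-++ x y)) (≈-sym (assoc _ _ _))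

    ev-∷ʳ : ∀ x i → ev (x ∷ʳ i) ≈ ev x ∙ g i
    ev-∷ʳ x i = ≈-trans (ev-++ x (i ∷ [])) (∙-congˡ (identityʳ _))

    ev-reverse : ∀ z → ev (reverse z) ≈ ev z ⁻¹
    ev-reverse []      = ≈-sym ε⁻¹≈ε
    ev-reverse (i ∷ z) = begin
      ev (reverse (i ∷ z))  ≡⟨ cong ev (List.unfold-reverse i z) ⟩
      ev (reverse z ∷ʳ i)   ≈⟨ ev-∷ʳ (reverse z) i ⟩
      ev (reverse z) ∙ g i  ≈⟨ ∙-congʳ (ev-reverse z) ⟩
      ev z ⁻¹ ∙ g i         ≈⟨ solve (invol (T-involutive (g∈T i)) ∷ free (ev z) ∷ []) (x₁ ⁻ ⊙ x₀) ((x₀ ⊙ x₁) ⁻) refl ⟩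
      (g i ∙ ev z) ⁻¹       ∎

    g-left : ∀ i w → g i ∙ (g i ∙ w) ≈ w
    g-left i w = solve (invol (T-involutive (g∈T i)) ∷ free w ∷ []) (x₀ ⊙ (x₀ ⊙ x₁)) x₁ refl

    -- Within H a letter has no inversion but itself. So at the first letter where the cocycle test
    -- succeeds, the letter is the conjugate of p by the preceding letters, and multiplying by p
    -- deletes it.
    exchange : ∀ z p → p ∈ H → ν (ev z) p ≡ true → ∃[ z′ ] (ev z′ ≈ p ∙ ev z × suc (length z′) ≡ length z)
    exchange [] p _ eq with () ← trans (sym (ν-ε p)) eq
    exchange (i ∷ z) p p∈ eq with ν (g i) p in eq₁
    ... | true = z , ≈-sym (≈-trans (∙-congʳ (canonical i p p∈ eq₁)) (g-left i _)) , refl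
    ... | false with exchange z (p ↑ g i) (↑∈ (g∈H i) p∈)
                     (trans (cong (_xor ν (ev z) (p ↑ g i)) (sym eq₁)) (trans (sym (ν-∙ (g i) (ev z) p)) eq))
    ...   | z′ , e′ , l′ = i ∷ z′ , ≈-trans (∙-congˡ e′)
      (solve (free (g i) ∷ free p ∷ free (ev z) ∷ []) (x₀ ⊙ (x₀ ⁻ ⊙ x₁ ⊙ x₀ ⊙ x₂)) (x₁ ⊙ (x₀ ⊙ x₂)) refl) , cong suc l′

    record Reduced (z : List I) : Set (e ⊔ i) where
      constructor reduced
      field
        shortest : ∀ z′ → ev z′ ≈ ev z → length z ≤ length z′

    open Reduced

    ν-first : ∀ {i z} → ν (ev z) (g i) ≡ false → ν (ev (i ∷ z)) (g i) ≡ true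
    ν-first {i} {z} eq = trans (ν-∙ (g i) (ev z) (g i)) (cong₂ _xor_ (ν-self (g∈T i)) (trans (ν-congʳ
      (solve (free (g i) ∷ []) (x₀ ⁻ ⊙ x₀ ⊙ x₀) x₀ refl)) eq))

    -- Any word for `ev (i ∷ z)` has `g i` among its inversions, so exchange turns it into a word
    -- for `ev z` with one letter less.
    ∷-reduced : ∀ {i z} → Reduced z → ν (ev z) (g i) ≡ false → Reduced (i ∷ z)
    ∷-reduced {i} {z} red eq .shortest z′ ev≈ with exchange z′ (g i) (g∈H i) (trans (ν-congˡ ev≈) (ν-first {z = z} eq))
    ... | z″ , e″ , l″ = subst (suc (length z) ≤_) l″
      (s≤s (shortest red z″ (≈-trans e″ (≈-trans (∙-congˡ ev≈) (g-left i _)))))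

    reduced-ascent : ∀ {i z} → Reduced (i ∷ z) → ν (ev z) (g i) ≡ false
    reduced-ascent {i} {z} red with ν (ev z) (g i) in eq
    ... | false = refl
    ... | true with exchange z (g i) (g∈H i) eq
    ...   | z″ , e″ , l″ = ⊥-elim (ℕ.<-irrefl refl (ℕ.<-trans (ℕ.n<1+n _)
      (subst (λ k → suc k ≤ length z″) (sym l″) (shortest red z″ e″))))

    reduced-first : ∀ {i z} → Reduced (i ∷ z) → ν (ev (i ∷ z)) (g i) ≡ true
    reduced-first {z = z} red = ν-first {z = z} (reduced-ascent red)

    reduced-suffix : ∀ x {y} → Reduced (x ++ y) → Reduced y
    reduced-suffix x {y} red .shortest z ev≈ = ℕ.+-cancelˡ-≤ (length x) _ _
      (subst₂ _≤_ (List.length-++ x) (List.length-++ x)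
        (shortest red (x ++ z) (≈-trans (ev-++ x z) (≈-trans (∙-congˡ ev≈) (≈-sym (ev-++ x y))))))

    reduced-prefix : ∀ {x} y → Reduced (x ++ y) → Reduced x
    reduced-prefix {x} y red .shortest z ev≈ = ℕ.+-cancelʳ-≤ (length y) _ _
      (subst₂ _≤_ (List.length-++ x) (List.length-++ z)
        (shortest red (z ++ y) (≈-trans (ev-++ z y) (≈-trans (∙-congʳ ev≈) (≈-sym (ev-++ x y))))))

    reduced-reverse : ∀ {z} → Reduced z → Reduced (reverse z)
    reduced-reverse {z} red .shortest z′ ev≈ = subst₂ _≤_ (sym (List.length-reverse z)) (List.length-reverse z′)
      (shortest red (reverse z′) (begin
        ev (reverse z′)       ≈⟨ ev-reverse z′ ⟩
        ev z′ ⁻¹              ≈⟨ ⁻¹-cong ev≈ ⟩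
        ev (reverse z) ⁻¹     ≈⟨ ⁻¹-cong (ev-reverse z) ⟩
        ev z ⁻¹ ⁻¹            ≈⟨ solve (free (ev z) ∷ []) (x₀ ⁻ ⁻) x₀ refl ⟩
        ev z                  ∎))

    ∷ʳ-reduced : ∀ {i z} → Reduced z → ν (ev z ⁻¹) (g i) ≡ false → Reduced (z ∷ʳ i)
    ∷ʳ-reduced {i} {z} red eq = subst Reduced
      (trans (List.unfold-reverse i (reverse z)) (cong (_∷ʳ i) (List.reverse-involutive z)))
      (reduced-reverse (∷-reduced (reduced-reverse red) (trans (ν-congˡ (ev-reverse z)) eq)))

    reduced-∷ʳ : ∀ {i z} → Reduced (z ∷ʳ i) → ν (ev z ⁻¹) (g i) ≡ false
    reduced-∷ʳ {i} {z} red = trans (ν-congˡ (≈-sym (ev-reverse z)))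
      (reduced-ascent (subst Reduced (List.reverse-++ z (i ∷ [])) (reduced-reverse red)))

    reduce : ∀ z → ∃[ z′ ] (Reduced z′ × ev z′ ≈ ev z)
    reduce [] = [] , reduced (λ _ _ → z≤n) , ≈-refl
    reduce (i ∷ z) with reduce z
    ... | z₁ , red , ev≈ with ν (ev z₁) (g i) in eq
    ...   | false = i ∷ z₁ , ∷-reduced red eq , ∙-congˡ ev≈
    ...   | true with exchange z₁ (g i) (g∈H i) eq
    ...     | z₂ , e₂ , l₂ = z₂ , red₂ , ≈-trans e₂ (∙-congˡ ev≈)
      where
      -- Prefixing `i` to any word for `ev z₂` gives a word for `ev z₁`, which has at least as many
      -- letters as `z₁`.
      red₂ : Reduced z₂
      red₂ .shortest z′ ev′ = s≤s⁻¹ (subst (_≤ suc (length z′)) (sym l₂)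
        (shortest red (i ∷ z′) (≈-trans (∙-congˡ (≈-trans ev′ e₂)) (g-left i _))))

    reducedWord : ∀ {a} {A : Pred Carrier a} → (∀ {w} → w ∈ A → ∃[ i ] w ≈ g i) →
      ∀ {w} → w ∈ ⟨ A ⟩ → ∃[ z ] (Reduced z × w ≈ ev z)
    reducedWord {A = A} letter w∈ with ⟨⟩-least words generator w∈
      where
      words : IsSubgroup (λ w → ∃[ z ] w ≈ ev z)
      words = record
        { ε∈    = [] , ≈-refl
        ; ∙∈    = λ where (y , p) (z , q) → y ++ z , ≈-trans (∙-cong p q) (≈-sym (ev-++ y z))
        ; ⁻¹∈   = λ where (z , p) → reverse z , ≈-trans (⁻¹-cong p) (≈-sym (ev-reverse z))
        ; resp∈ = λ where eq (z , p) → z , ≈-trans (≈-sym eq) p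
        }
      generator : A ⊆ (λ w → ∃[ z ] w ≈ ev z)
      generator wA with letter wA
      ... | i , eq = i ∷ [] , ≈-trans eq (≈-sym (identityʳ _))
    ... | z , eq with reduce z
    ...   | z′ , red , eq′ = z′ , red , ≈-trans eq (≈-sym eq′)

  private
    everything : IsSubgroup (λ _ → ⊤ {c})
    everything = record { ε∈ = tt ; ∙∈ = λ _ _ → tt ; ⁻¹∈ = λ _ → tt ; resp∈ = λ _ _ → tt }

  s-canonical : ∀ i p → ν (s i) p ≡ true → p ≈ s i
  s-canonical i p eq = same⇒≈ (trans (sym (ν-s i p)) eq)

  private
    module S = Words s everything s∈T (λ _ → tt) (λ i p _ → s-canonical i p)

  -- Exchange over S, applied to a word of length `ℓ w`, gives a word for t w with one letter less.
  ν-true : ∀ {w t} → ν w t ≡ true → ℓ (t ∙ w) < ℓ w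
  ν-true {w} {t} eq with attained w
  ... | x , ev , l with S.exchange x t tt (trans (ν-congˡ ev) eq)
  ...   | y , ev′ , l′ = subst (suc (ℓ (t ∙ w)) ≤_) (trans l′ l) (s≤s (minimal _ y (≈-trans ev′ (∙-congˡ ev))))

  ν⇒T : ∀ {w t} → ν w t ≡ true → t ∈ T
  ν⇒T {w} {t} = go (word w) t
    where
    go : ∀ x t → η x t ≡ true → t ∈ T
    go (i ∷ x) t eq with same t (s i) in eq₁
    ... | true  = T-resp (≈-sym (same⇒≈ eq₁)) (s∈T i)
    ... | false = T-resp (↑-cancel′ t (s i)) (T-↑ (s i ⁻¹) (go x (t ↑ s i) eq))

  -- Left multiplication by t flips the test at t, so `ν-true` applies to t w.
  ν-false : ∀ {w t} → t ∈ T → ν w t ≡ false → ℓ w < ℓ (t ∙ w)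
  ν-false {w} {t} tT eq = subst (_< ℓ (t ∙ w)) (ℓ-cong twice) (ν-true (trans (ν-∙ t w t)
    (cong₂ _xor_ (ν-self tT) (trans (ν-congʳ (solve (free t ∷ []) (x₀ ⁻ ⊙ x₀ ⊙ x₀) x₀ refl)) eq))))
    where
    twice : t ∙ (t ∙ w) ≈ w
    twice = solve (invol (T-involutive tT) ∷ free w ∷ []) (x₀ ⊙ (x₀ ⊙ x₁)) x₁ refl

  <⇒ν-true : ∀ {w t} → t ∈ T → ℓ (t ∙ w) < ℓ w → ν w t ≡ true
  <⇒ν-true {w} {t} tT lt with ν w t in eq
  ... | true  = refl
  ... | false = ⊥-elim (ℕ.<-asym lt (ν-false tT eq))

  <⇒ν-false : ∀ {w t} → ℓ w < ℓ (t ∙ w) → ν w t ≡ false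
  <⇒ν-false {w} {t} lt with ν w t in eq
  ... | true  = ⊥-elim (ℕ.<-asym lt (ν-true eq))
  ... | false = refl

  -- The sign character. It makes reduced words of reflections odd and separates reflections from
  -- rotations in a dihedral subgroup.
  sign : Carrier → Bool
  sign w = parity (word w)

  sign-eval : ∀ x {w} → eval x ≈ w → sign w ≡ parity x
  sign-eval x ev = parity-∼ (presented (word _) x (≈-trans (proj₂ (generates _)) (≈-sym ev)))

  sign-cong : ∀ {w w′} → w ≈ w′ → sign w ≡ sign w′
  sign-cong {w} {w′} p = sign-eval (word w′) (≈-trans (proj₂ (generates w′)) (≈-sym p))

  sign-∙ : ∀ x y → sign (x ∙ y) ≡ sign x xor sign y
  sign-∙ x y = trans
    (sign-eval (word x ++ word y) (≈-trans (eval-++ (word x) _) (∙-cong (proj₂ (generates x)) (proj₂ (generates y)))))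
    (parity-++ (word x) (word y))

  sign-ε : sign ε ≡ false
  sign-ε = sign-eval [] ≈-refl

  sign-⁻¹ : ∀ w → sign (w ⁻¹) ≡ sign w
  sign-⁻¹ w = sym (xor-false (trans (sym (sign-∙ w (w ⁻¹))) (trans (sign-cong (inverseʳ w)) sign-ε)))

  sign-T : ∀ {t} → t ∈ T → sign t ≡ true
  sign-T {t} (w , i , eq) = trans (sign-cong eq) (trans (sign-∙ _ _)
    (trans (cong₂ _xor_ (trans (sign-∙ w (s i)) (cong (sign w xor_) (sign-eval (i ∷ []) (identityʳ _)))) (sign-⁻¹ w))
      (flip (sign w))))
    where
    flip : ∀ b → (b xor true) xor b ≡ true
    flip true  = refl
    flip false = refl

  -- Double negation and shortest coset elements.

  infixl 1 _>>=_

  _>>=_ : ∀ {a b} {A : Set a} {B : Set b} → ¬ ¬ A → (A → ¬ ¬ B) → ¬ ¬ B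
  (m >>= f) k = m (λ a → f a k)

  return : ∀ {a} {A : Set a} → A → ¬ ¬ A
  return a k = k a

  -- x is the element of minimal length in the coset H x.
  Bottom : ∀ {h} → Pred Carrier h → Pred Carrier _
  Bottom H x = ∀ p → p ∈ H → ν x p ≡ false

  module Cosets {h} {H : Pred Carrier h} (H-sub : IsSubgroup H) where

    open IsSubgroup H-sub

    bottom-exists : ∀ u → ¬ ¬ (∃[ x ] ∃[ w ] (w ∈ H × u ≈ w ∙ x × Bottom H x))
    bottom-exists u = go (suc (ℓ u)) u ℕ.≤-refl
      where
      nothing-below : ∀ {u} → ¬ (∃[ p ] (p ∈ H × ν u p ≡ true)) → Bottom H u
      nothing-below {u} none p pH with ν u p in eq
      ... | true  = ⊥-elim (none (p , pH , eq))
      ... | false = refl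

      go : ∀ k u → ℓ u < k → ¬ ¬ (∃[ x ] ∃[ w ] (w ∈ H × u ≈ w ∙ x × Bottom H x))
      go (suc k) u (s≤s u≤k) = ¬¬-excluded-middle {A = ∃[ p ] (p ∈ H × ν u p ≡ true)} >>= λ where
        (yes (p , pH , eq)) → go k (p ∙ u) (ℕ.<-≤-trans (ν-true eq) u≤k) >>= λ where
          (x , w , wH , eq′ , bot) → return (x , p ⁻¹ ∙ w , ∙∈ (⁻¹∈ pH) wH ,
            ≈-trans (solve (free p ∷ free u ∷ []) x₁ (x₀ ⁻ ⊙ (x₀ ⊙ x₁)) refl)
              (≈-trans (∙-congˡ eq′) (≈-sym (assoc _ _ _))) , bot)
        (no none) → return (u , ε , ε∈ , ≈-sym (identityˡ u) , nothing-below none)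

    -- Conjugation by w keeps p in H, where x has no inversions, so the second cocycle term
    -- vanishes. This transfers comparisons by reflections of H from the coset H x to H itself.
    ν-coset : ∀ {x w p} → Bottom H x → w ∈ H → p ∈ H → ν (w ∙ x) p ≡ ν w p
    ν-coset {x} {w} {p} bot wH pH = trans (ν-∙ w x p)
      (trans (cong (ν w p xor_) (bot _ (↑∈ wH pH))) (xor-identityʳ _))

-- Canonical generators and Dyer's theorem.

module CanonicalGenerators {c e : Level} (𝒲 : CoxeterSystem c e) (len : LengthFunction 𝒲) where

  open N-cocycle 𝒲 len public

  centralizer-isSubgroup : ∀ z → IsSubgroup (λ x → x ∙ z ≈ z ∙ x)
  centralizer-isSubgroup z = record
    { ε∈    = ≈-trans (identityˡ z) (≈-sym (identityʳ z))
    ; ∙∈    = λ {x} {y} p q → begin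
        x ∙ y ∙ z    ≈⟨ assoc x y z ⟩
        x ∙ (y ∙ z)  ≈⟨ ∙-congˡ q ⟩
        x ∙ (z ∙ y)  ≈⟨ assoc x z y ⟨
        x ∙ z ∙ y    ≈⟨ ∙-congʳ p ⟩
        z ∙ x ∙ y    ≈⟨ assoc z x y ⟩
        z ∙ (x ∙ y)  ∎
    ; ⁻¹∈   = λ {x} p → begin
        x ⁻¹ ∙ z                ≈⟨ solve (free x ∷ free z ∷ []) (x₀ ⁻ ⊙ x₁) (x₀ ⁻ ⊙ (x₁ ⊙ x₀) ⊙ x₀ ⁻) refl ⟩
        x ⁻¹ ∙ (z ∙ x) ∙ x ⁻¹   ≈⟨ ∙-congʳ (∙-congˡ p) ⟨
        x ⁻¹ ∙ (x ∙ z) ∙ x ⁻¹   ≈⟨ solve (free x ∷ free z ∷ []) (x₀ ⁻ ⊙ (x₀ ⊙ x₁) ⊙ x₀ ⁻) (x₁ ⊙ x₀ ⁻) refl ⟩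
        z ∙ x ⁻¹                ∎
    ; resp∈ = λ eq p → ≈-trans (∙-congʳ (≈-sym eq)) (≈-trans p (∙-congˡ eq))
    }

  ⟨⟩-commutative : ∀ {a} {A : Pred Carrier a} → (∀ {x y} → x ∈ A → y ∈ A → x ∙ y ≈ y ∙ x) →
                   ∀ {x y} → x ∈ ⟨ A ⟩ → y ∈ ⟨ A ⟩ → x ∙ y ≈ y ∙ x
  ⟨⟩-commutative comm {x} {y} xA yA = ⟨⟩-least (centralizer-isSubgroup y)
    (λ x′A → ≈-sym (⟨⟩-least (centralizer-isSubgroup _) (λ y′A → comm y′A x′A) yA)) xA

  pair-isSubgroup : ∀ {z} → z ∙ z ≈ ε → IsSubgroup (λ x → x ≈ ε ⊎ x ≈ z)
  pair-isSubgroup {z} z² = record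
    { ε∈    = inj₁ ≈-refl
    ; ∙∈    = λ where
        (inj₁ p) (inj₁ q) → inj₁ (≈-trans (∙-cong p q) (identityˡ ε))
        (inj₁ p) (inj₂ q) → inj₂ (≈-trans (∙-cong p q) (identityˡ z))
        (inj₂ p) (inj₁ q) → inj₂ (≈-trans (∙-cong p q) (identityʳ z))
        (inj₂ p) (inj₂ q) → inj₁ (≈-trans (∙-cong p q) z²)
    ; ⁻¹∈   = λ where
        (inj₁ p) → inj₁ (≈-trans (⁻¹-cong p) ε⁻¹≈ε)
        (inj₂ p) → inj₂ (≈-trans (⁻¹-cong p) (≈-sym (inverseʳ-unique z z z²)))
    ; resp∈ = λ eq → λ where
        (inj₁ p) → inj₁ (≈-trans (≈-sym eq) p)
        (inj₂ p) → inj₂ (≈-trans (≈-sym eq) p)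
    }

  -- CanonicalGenerator, with the decision procedure ν in place of N.
  Can : ∀ {a} → Pred Carrier a → Pred Carrier (c ⊔ e ⊔ a)
  Can H t = t ∈ T × t ∈ H × (∀ p → p ∈ H → ν t p ≡ true → p ≈ t)

  Can-resp : ∀ {a} {H : Pred Carrier a} → IsSubgroup H → ∀ {t t′} → t ≈ t′ → t ∈ Can H → t′ ∈ Can H
  Can-resp H-sub eq (tT , tH , can) = T-resp eq tT , IsSubgroup.resp∈ H-sub eq tH ,
    λ p pH νt → ≈-trans (can p pH (trans (ν-congˡ eq) νt)) eq

  s∈Can : ∀ {a} {H : Pred Carrier a} i → s i ∈ H → s i ∈ Can H
  s∈Can i sH = s∈T i , sH , λ p _ → s-canonical i p

  module Conjugate {a} {H : Pred Carrier a} (H-sub : IsSubgroup H) (j : Fin n) where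

    open IsSubgroup H-sub

    -- The conjugate subgroup s H s⁻¹ for s = `s j`.
    Hʲ : Pred Carrier a
    Hʲ p = p ↑ s j ∈ H

    Hʲ-isSubgroup : IsSubgroup Hʲ
    Hʲ-isSubgroup = record
      { ε∈    = resp∈ (solve (free (s j) ∷ []) one (x₀ ⁻ ⊙ one ⊙ x₀) refl) ε∈
      ; ∙∈    = λ {x} {y} p q → resp∈ (solve (free (s j) ∷ free x ∷ free y ∷ [])
                  (x₀ ⁻ ⊙ x₁ ⊙ x₀ ⊙ (x₀ ⁻ ⊙ x₂ ⊙ x₀)) (x₀ ⁻ ⊙ (x₁ ⊙ x₂) ⊙ x₀) refl) (∙∈ p q)
      ; ⁻¹∈   = λ {x} p → resp∈ (solve (free (s j) ∷ free x ∷ [])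
                  ((x₀ ⁻ ⊙ x₁ ⊙ x₀) ⁻) (x₀ ⁻ ⊙ x₁ ⁻ ⊙ x₀) refl) (⁻¹∈ p)
      ; resp∈ = λ eq → resp∈ (↑-cong eq ≈-refl)
      }

    -- Expand the cocycle of s⁻¹ p s at q ∈ H: each outer letter s can contribute only if s itself
    -- lies in H, so what is left is the test of p at the conjugate of q.
    Can-conjugate : ¬ s j ∈ H → ∀ {p} → p ∈ Can Hʲ → p ↑ s j ∈ Can H
    Can-conjugate s∉H {p} (pT , pH , can) = T-↑ (s j) pT , pH , λ q qH νq →
      ↑-move′ (can (q ↑ s j ⁻¹) (resp∈ (≈-sym (↑-cancel q (s j))) qH) (middle q qH νq))
      where
      outer : ∀ q → q ∈ H → ν (s j) q ≡ false
      outer q qH with ν (s j) q in eq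
      ... | true  = ⊥-elim (s∉H (resp∈ (s-canonical j q eq) qH))
      ... | false = refl
      inner : ∀ q → q ∈ H → ν (s j) (q ↑ (s j ⁻¹ ∙ p)) ≡ false
      inner q qH with ν (s j) (q ↑ (s j ⁻¹ ∙ p)) in eq
      ... | false = refl
      ... | true  = ⊥-elim (s∉H (resp∈ (begin
        q ↑ (p ↑ s j)               ≈⟨ ↑-∙ q (s j ⁻¹ ∙ p) (s j) ⟨
        q ↑ (s j ⁻¹ ∙ p) ↑ s j      ≈⟨ ↑-cong (s-canonical j _ eq) ≈-refl ⟩
        s j ↑ s j                   ≈⟨ solve (free (s j) ∷ []) (x₀ ⁻ ⊙ x₀ ⊙ x₀) x₀ refl ⟩
        s j                         ∎) (↑∈ pH qH)))
      middle : ∀ q → q ∈ H → ν (p ↑ s j) q ≡ true → ν p (q ↑ s j ⁻¹) ≡ true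
      middle q qH νq = trans
        (sym (trans (ν-∙ (s j ⁻¹ ∙ p) (s j) q) (trans (cong₂ _xor_
          (trans (ν-∙ (s j ⁻¹) p q) (cong (_xor ν p (q ↑ s j ⁻¹)) (trans (ν-congˡ (T-⁻¹ (s∈T j))) (outer q qH))))
          (inner q qH)) (xor-identityʳ _)))) νq

  -- Dyer: conjugating by a simple reflection outside H carries canonical
  -- generators to canonical generators.
  Can-generates-word : ∀ {a} y i {H : Pred Carrier a} → IsSubgroup H → ∀ {r} →
    r ≈ eval y ∙ s i ∙ eval y ⁻¹ → r ∈ H → ¬ ¬ (r ∈ ⟨ Can H ⟩)
  Can-generates-word [] i H-sub eq rH = return (incl (Can-resp H-sub (≈-sym r≈s)
    (s∈Can i (IsSubgroup.resp∈ H-sub r≈s rH))))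
    where
    r≈s = ≈-trans eq (solve (free (s i) ∷ []) (one ⊙ x₀ ⊙ one ⁻) x₀ refl)
  Can-generates-word (j ∷ y) i {H} H-sub {r} eq rH = ¬¬-excluded-middle >>= by
    where
    open IsSubgroup H-sub
    open Conjugate H-sub j
    s² = s-involutive j
    eq′ : r ↑ s j ≈ eval y ∙ s i ∙ eval y ⁻¹
    eq′ = ≈-trans (↑-cong eq ≈-refl) (solve (invol s² ∷ free (eval y) ∷ free (s i) ∷ [])
      (x₀ ⁻ ⊙ (x₀ ⊙ x₁ ⊙ x₂ ⊙ (x₀ ⊙ x₁) ⁻) ⊙ x₀) (x₁ ⊙ x₂ ⊙ x₁ ⁻) refl)
    back : s j ∙ (r ↑ s j) ∙ s j ≈ r
    back = solve (invol s² ∷ free r ∷ []) (x₀ ⊙ (x₀ ⁻ ⊙ x₁ ⊙ x₀) ⊙ x₀) x₁ refl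
    twice : r ↑ s j ↑ s j ≈ r
    twice = solve (invol s² ∷ free r ∷ []) (x₀ ⁻ ⊙ (x₀ ⁻ ⊙ x₁ ⊙ x₀) ⊙ x₀) x₁ refl
    -- Both cases pass to `r ↑ s j`, whose conjugating word is shorter. If `s j` lies in H this
    -- reflection is still in H; otherwise it lies in the conjugate of H, which is why H varies in
    -- the induction.
    by : Dec (s j ∈ H) → ¬ ¬ (r ∈ ⟨ Can H ⟩)
    by (yes sH) = Can-generates-word y i H-sub eq′ (↑∈ sH rH) >>= λ gen →
      return (resp back (mult (mult (incl (s∈Can j sH)) gen) (incl (s∈Can j sH))))
    by (no s∉H) = Can-generates-word y i Hʲ-isSubgroup eq′ (resp∈ (≈-sym twice) rH) >>= λ gen →
      return (resp twice (⟨⟩-least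
        (Conjugate.Hʲ-isSubgroup (⟨⟩-isSubgroup (Can H)) j) (λ can → incl (Can-conjugate s∉H can)) gen))

  Can-generates : ∀ {a} {H : Pred Carrier a} → IsSubgroup H → ∀ {r} → r ∈ T → r ∈ H → ¬ ¬ (r ∈ ⟨ Can H ⟩)
  Can-generates H-sub (w , i , eq) = Can-generates-word (word w) i H-sub
    (≈-trans eq (∙-cong (∙-congʳ (≈-sym w≈)) (⁻¹-cong (≈-sym w≈))))
    where
    w≈ = proj₂ (generates w)

  -- Lifted because the generating sets allowed in `_⊑′_` live at level `c ⊔ e`.
  Pair : Carrier → Carrier → Pred Carrier (c ⊔ e)
  Pair a b w = Lift (c ⊔ e) (w ≈ a ⊎ w ≈ b)

  pattern first p  = lift (inj₁ p)
  pattern second p = lift (inj₂ p)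

  pigeonhole : ∀ {a b d x y} → ¬ a ≈ b → ¬ a ≈ d → ¬ b ≈ d →
    a ≈ x ⊎ a ≈ y → b ≈ x ⊎ b ≈ y → d ≈ x ⊎ d ≈ y → ⊥
  pigeonhole ab ad bd (inj₁ p) (inj₁ q) _        = ab (≈-trans p (≈-sym q))
  pigeonhole ab ad bd (inj₁ p) (inj₂ q) (inj₁ r) = ad (≈-trans p (≈-sym r))
  pigeonhole ab ad bd (inj₁ p) (inj₂ q) (inj₂ r) = bd (≈-trans q (≈-sym r))
  pigeonhole ab ad bd (inj₂ p) (inj₂ q) _        = ab (≈-trans p (≈-sym q))
  pigeonhole ab ad bd (inj₂ p) (inj₁ q) (inj₁ r) = bd (≈-trans q (≈-sym r))
  pigeonhole ab ad bd (inj₂ p) (inj₁ q) (inj₂ r) = ad (≈-trans p (≈-sym r))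

  -- A subgroup generated by two reflections r and t has at most two canonical
  -- generators: three of them would commute, so r and t would commute, leaving
  -- no reflections besides r and t.
  module TwoReflections {r t : Carrier} (rT : r ∈ T) (tT : t ∈ T) where

    H : Pred Carrier (c ⊔ e)
    H = ⟨ Pair r t ⟩

    H-sub : IsSubgroup H
    H-sub = ⟨⟩-isSubgroup (Pair r t)

    open IsSubgroup H-sub

    private
      r² = T-involutive rT
      t² = T-involutive tT

    Rotation : Pred Carrier (c ⊔ e)
    Rotation = ⟨ (λ w → w ≈ r ∙ t) ⟩

    Rotation-commutative : ∀ {x y} → x ∈ Rotation → y ∈ Rotation → x ∙ y ≈ y ∙ x
    Rotation-commutative = ⟨⟩-commutative (λ p q → ≈-trans (∙-cong p q) (≈-sym (∙-cong q p)))

    Rotation-even : ∀ {x} → x ∈ Rotation → sign x ≡ false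
    Rotation-even = ⟨⟩-least
      (record
        { ε∈    = sign-ε
        ; ∙∈    = λ {x} {y} p q → trans (sign-∙ x y) (cong₂ _xor_ p q)
        ; ⁻¹∈   = λ {x} p → trans (sign-⁻¹ x) p
        ; resp∈ = λ eq p → trans (sign-cong (≈-sym eq)) p
        })
      (λ eq → trans (sign-cong eq) (trans (sign-∙ r t) (cong₂ _xor_ (sign-T rT) (sign-T tT))))

    r-inverts : ∀ {x} → x ∈ Rotation → r ∙ x ∙ r ≈ x ⁻¹
    r-inverts (incl eq) = ≈-trans (∙-congʳ (∙-congˡ eq)) (≈-trans
      (solve (invol r² ∷ invol t² ∷ []) (x₀ ⊙ (x₀ ⊙ x₁) ⊙ x₀) ((x₀ ⊙ x₁) ⁻) refl) (⁻¹-cong (≈-sym eq)))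
    r-inverts unit = solve (invol r² ∷ []) (x₀ ⊙ one ⊙ x₀) (one ⁻) refl
    r-inverts (mult {x} {y} p q) = begin
      r ∙ (x ∙ y) ∙ r            ≈⟨ solve (invol r² ∷ free x ∷ free y ∷ []) (x₀ ⊙ (x₁ ⊙ x₂) ⊙ x₀) (x₀ ⊙ x₁ ⊙ x₀ ⊙ (x₀ ⊙ x₂ ⊙ x₀)) refl ⟩
      r ∙ x ∙ r ∙ (r ∙ y ∙ r)    ≈⟨ ∙-cong (r-inverts p) (r-inverts q) ⟩
      x ⁻¹ ∙ y ⁻¹                ≈⟨ solve (free x ∷ free y ∷ []) (x₀ ⁻ ⊙ x₁ ⁻) ((x₁ ⊙ x₀) ⁻) refl ⟩
      (y ∙ x) ⁻¹                 ≈⟨ ⁻¹-cong (Rotation-commutative q p) ⟩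
      (x ∙ y) ⁻¹                 ∎
    r-inverts (inv {x} p) = ≈-trans
      (solve (invol r² ∷ free x ∷ []) (x₀ ⊙ x₁ ⁻ ⊙ x₀) ((x₀ ⊙ x₁ ⊙ x₀) ⁻) refl) (⁻¹-cong (r-inverts p))
    r-inverts (resp eq p) = ≈-trans (∙-congʳ (∙-congˡ (≈-sym eq))) (≈-trans (r-inverts p) (⁻¹-cong eq))

    OddElement : Pred Carrier (c ⊔ e)
    OddElement w = ∃[ x ] (x ∈ Rotation × w ≈ x ∙ r)

    odd-product : ∀ {u v} → u ∈ OddElement → v ∈ OddElement → u ∙ v ∈ Rotation
    odd-product (x , px , eqx) (y , py , eqy) = resp
      (≈-trans (≈-trans (∙-congˡ (≈-sym (r-inverts py)))
        (solve (invol r² ∷ free x ∷ free y ∷ []) (x₁ ⊙ (x₀ ⊙ x₂ ⊙ x₀)) (x₁ ⊙ x₀ ⊙ (x₂ ⊙ x₀)) refl))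
        (≈-sym (∙-cong eqx eqy)))
      (mult px (inv py))

    dihedral-isSubgroup : IsSubgroup (λ w → w ∈ Rotation ⊎ w ∈ OddElement)
    dihedral-isSubgroup = record
      { ε∈    = inj₁ unit
      ; ∙∈    = λ where
          (inj₁ p) (inj₁ q) → inj₁ (mult p q)
          (inj₁ p) (inj₂ (y , q , eq)) → inj₂ (_ , mult p q , ≈-trans (∙-congˡ eq) (≈-sym (assoc _ _ _)))
          (inj₂ (x , p , eq)) (inj₁ q) → inj₂ (_ , mult p (inv q) , ≈-trans (∙-congʳ eq) (reorder q))
          (inj₂ p) (inj₂ q) → inj₁ (odd-product p q)
      ; ⁻¹∈   = λ where
          (inj₁ p) → inj₁ (inv p)
          (inj₂ (x , p , eq)) → inj₂ (x , p , ≈-trans (⁻¹-cong eq) (≈-trans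
            (solve (invol r² ∷ free x ∷ []) ((x₁ ⊙ x₀) ⁻) (x₀ ⊙ x₁ ⁻ ⊙ x₀ ⊙ x₀) refl)
            (∙-congʳ (≈-trans (r-inverts (inv p)) (solve (free x ∷ []) (x₀ ⁻ ⁻) x₀ refl)))))
      ; resp∈ = λ eq → λ where
          (inj₁ p) → inj₁ (resp eq p)
          (inj₂ (x , p , eq′)) → inj₂ (x , p , ≈-trans (≈-sym eq) eq′)
      }
      where
      reorder : ∀ {x y} → y ∈ Rotation → x ∙ r ∙ y ≈ x ∙ y ⁻¹ ∙ r
      reorder {x} {y} q = ≈-trans
        (solve (invol r² ∷ free x ∷ free y ∷ []) (x₁ ⊙ x₀ ⊙ x₂) (x₁ ⊙ (x₀ ⊙ x₂ ⊙ x₀) ⊙ x₀) refl)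
        (∙-congʳ (∙-congˡ (r-inverts q)))

    reflection-odd : ∀ {w} → w ∈ T → w ∈ H → w ∈ OddElement
    reflection-odd wT wH with ⟨⟩-least dihedral-isSubgroup generators wH
      where
      generators : Pair r t ⊆ (λ w → w ∈ Rotation ⊎ w ∈ OddElement)
      generators (first eq)  = inj₂ (ε , unit , ≈-trans eq (≈-sym (identityˡ r)))
      generators (second eq) = inj₂ ((r ∙ t) ⁻¹ , inv (incl ≈-refl) , ≈-trans eq
        (solve (invol r² ∷ invol t² ∷ []) x₁ ((x₀ ⊙ x₁) ⁻ ⊙ x₀) refl))
    ... | inj₂ p = p
    ... | inj₁ p with () ← trans (sym (Rotation-even p)) (sign-T wT)

    odd-inverts : ∀ {w x} → w ∈ OddElement → x ∈ Rotation → w ∙ x ∙ w ≈ x ⁻¹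
    odd-inverts {w} {x} (y , py , eq) px = begin
      w ∙ x ∙ w                ≈⟨ ∙-cong (∙-congʳ eq) eq ⟩
      y ∙ r ∙ x ∙ (y ∙ r)      ≈⟨ solve (free r ∷ free x ∷ free y ∷ []) (x₂ ⊙ x₀ ⊙ x₁ ⊙ (x₂ ⊙ x₀)) (x₂ ⊙ (x₀ ⊙ (x₁ ⊙ x₂) ⊙ x₀)) refl ⟩
      y ∙ (r ∙ (x ∙ y) ∙ r)    ≈⟨ ∙-congˡ (r-inverts (mult px py)) ⟩
      y ∙ (x ∙ y) ⁻¹           ≈⟨ solve (free x ∷ free y ∷ []) (x₁ ⊙ (x₀ ⊙ x₁) ⁻) (x₀ ⁻) refl ⟩
      x ⁻¹                     ∎

    Can-odd : ∀ {a} → a ∈ Can H → a ∈ OddElement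
    Can-odd (aT , aH , _) = reflection-odd aT aH

    Can-disjoint : ∀ {a p} → a ∈ Can H → p ∈ H → ¬ p ≈ a → ν a p ≡ false
    Can-disjoint {a} {p} (_ , _ , can) pH ne with ν a p in eq
    ... | true  = ⊥-elim (ne (can p pH eq))
    ... | false = refl

    ↑-self : ∀ a → a ↑ a ≈ a
    ↑-self a = solve (free a ∷ []) (x₀ ⁻ ⊙ x₀ ⊙ x₀) x₀ refl

    -- If a b a were d, it would not have a as an inversion. Its first letter contributes a, so the
    -- last letter must contribute it again, which forces `a ↑ b ≈ a`. Then a and b commute and
    -- `b ↑ a` is b, not d.
    conjugate-not-canonical : ∀ {a b d} → a ∈ Can H → b ∈ Can H → d ∈ Can H →
      ¬ a ≈ b → ¬ a ≈ d → ¬ b ≈ d → ¬ b ↑ a ≈ d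
    conjugate-not-canonical {a} {b} {d} a∈ b∈ d∈ ab ad bd eq = bd (begin
      b           ≈⟨ solve (free a ∷ free b ∷ []) x₁ (x₀ ⁻ ⊙ x₁ ⊙ (x₁ ⁻ ⊙ x₀ ⊙ x₁)) refl ⟩
      a ⁻¹ ∙ b ∙ (a ↑ b)  ≈⟨ ∙-congˡ fixed ⟩
      b ↑ a       ≈⟨ eq ⟩
      d           ∎)
      where
      aT = proj₁ a∈
      aH = proj₁ (proj₂ a∈)
      bH = proj₁ (proj₂ b∈)
      expand : ν (b ↑ a) a ≡ (true xor false) xor ν a (a ↑ b)
      expand = trans (ν-∙ (a ⁻¹ ∙ b) a a) (cong₂ _xor_
        (trans (ν-∙ (a ⁻¹) b a) (cong₂ _xor_ (trans (ν-congˡ (T-⁻¹ aT)) (ν-self aT))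
          (trans (ν-congʳ (solve (free a ∷ []) (x₀ ⁻ ⁻ ⊙ x₀ ⊙ x₀ ⁻) x₀ refl)) (Can-disjoint b∈ aH ab))))
        (ν-congʳ (solve (free a ∷ free b ∷ []) ((x₀ ⁻ ⊙ x₁) ⁻ ⊙ x₀ ⊙ (x₀ ⁻ ⊙ x₁)) (x₁ ⁻ ⊙ x₀ ⊙ x₁) refl)))
      flips : ∀ {x} → false ≡ (true xor false) xor x → x ≡ true
      flips {true} _ = refl
      fixed : a ↑ b ≈ a
      fixed = proj₂ (proj₂ a∈) (a ↑ b) (↑∈ bH aH)
        (flips (trans (sym (trans (ν-congˡ eq) (Can-disjoint d∈ aH ad))) expand))

    -- Compare ν _ b on both sides of b a d = d a b.
    three-commute : ∀ {a b d} → a ∈ Can H → b ∈ Can H → d ∈ Can H →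
      ¬ a ≈ b → ¬ a ≈ d → ¬ b ≈ d → a ∙ d ≈ d ∙ a
    three-commute {a} {b} {d} a∈ b∈ d∈ ab ad bd = begin
      a ∙ d                      ≈⟨ solve (invol a² ∷ invol d² ∷ []) (x₀ ⊙ x₁) ((x₁ ⊙ x₀) ⁻) refl ⟩
      (d ∙ a) ⁻¹                 ≈⟨ odd-inverts (Can-odd b∈) (odd-product (Can-odd d∈) (Can-odd a∈)) ⟨
      b ∙ (d ∙ a) ∙ b            ≈⟨ solve (free a ∷ free b ∷ free d ∷ [])
        (x₁ ⊙ (x₂ ⊙ x₀) ⊙ x₁) (x₂ ⊙ x₀ ⊙ ((x₂ ⊙ x₀) ⁻ ⊙ x₁ ⊙ (x₂ ⊙ x₀)) ⊙ x₁) refl ⟩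
      d ∙ a ∙ b ↑ (d ∙ a) ∙ b    ≈⟨ ∙-congʳ (∙-congˡ fixed) ⟩
      d ∙ a ∙ b ∙ b              ≈⟨ solve (free a ∷ invol b² ∷ free d ∷ []) (x₂ ⊙ x₀ ⊙ x₁ ⊙ x₁) (x₂ ⊙ x₀) refl ⟩
      d ∙ a                      ∎
      where
      aH = proj₁ (proj₂ a∈)
      bH = proj₁ (proj₂ b∈)
      dH = proj₁ (proj₂ d∈)
      a² = T-involutive (proj₁ a∈)
      b² = T-involutive (proj₁ b∈)
      d² = T-involutive (proj₁ d∈)
      swap : b ∙ a ∙ d ≈ d ∙ a ∙ b
      swap = begin
        b ∙ a ∙ d              ≈⟨ solve (free a ∷ invol b² ∷ free d ∷ []) (x₁ ⊙ x₀ ⊙ x₂) (x₁ ⊙ (x₀ ⊙ x₂) ⊙ x₁ ⊙ x₁) refl ⟩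
        b ∙ (a ∙ d) ∙ b ∙ b    ≈⟨ ∙-congʳ (odd-inverts (Can-odd b∈) (odd-product (Can-odd a∈) (Can-odd d∈))) ⟩
        (a ∙ d) ⁻¹ ∙ b         ≈⟨ solve (invol a² ∷ free b ∷ invol d² ∷ []) ((x₀ ⊙ x₂) ⁻ ⊙ x₁) (x₂ ⊙ x₀ ⊙ x₁) refl ⟩
        d ∙ a ∙ b              ∎
      left : ν (b ∙ a ∙ d) b ≡ true
      left = trans (ν-∙ (b ∙ a) d b) (cong₂ _xor_
        (trans (ν-∙ b a b) (cong₂ _xor_ (ν-self (proj₁ b∈))
          (trans (ν-congʳ (↑-self b)) (Can-disjoint a∈ bH (λ eq → ab (≈-sym eq))))))
        (trans (ν-congʳ (≈-trans (≈-sym (↑-∙ b b a)) (↑-cong (↑-self b) ≈-refl)))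
          (Can-disjoint d∈ (↑∈ aH bH) (conjugate-not-canonical a∈ b∈ d∈ ab ad bd))))
      right : ν (d ∙ a ∙ b) b ≡ ν b (b ↑ (d ∙ a))
      right = trans (ν-∙ (d ∙ a) b b) (cong (_xor ν b (b ↑ (d ∙ a)))
        (trans (ν-∙ d a b) (cong₂ _xor_ (Can-disjoint d∈ bH bd)
          (Can-disjoint a∈ (↑∈ dH bH) (conjugate-not-canonical d∈ b∈ a∈
            (λ eq → bd (≈-sym eq)) (λ eq → ad (≈-sym eq)) (λ eq → ab (≈-sym eq)))))))
      fixed : b ↑ (d ∙ a) ≈ b
      fixed = proj₂ (proj₂ b∈) _ (↑∈ (∙∈ dH aH) bH) (trans (sym right) (trans (ν-congˡ (≈-sym swap)) left))

    at-most-two : ∀ {a b d} → a ∈ Can H → b ∈ Can H → d ∈ Can H → ¬ a ≈ b → ¬ a ≈ d → ¬ b ≈ d → ⊥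
    at-most-two {a} {b} {d} a∈ b∈ d∈ ab ad bd =
      Can-generates H-sub rT (incl (first ≈-refl)) λ r∈ →
      Can-generates H-sub tT (incl (second ≈-refl)) λ t∈ →
      let is = only (⟨⟩-commutative commute r∈ t∈) in
      pigeonhole ab ad bd (is (Can-odd a∈)) (is (Can-odd b∈)) (is (Can-odd d∈))
      where
      -- If x and y are distinct, one of a, b, d differs from both and serves as the middle element
      -- in `three-commute`.
      commute : ∀ {x y} → x ∈ Can H → y ∈ Can H → x ∙ y ≈ y ∙ x
      commute {x} {y} x∈ y∈ with x ≈? y | (a ≈? x ⊎-dec a ≈? y) | (b ≈? x ⊎-dec b ≈? y) | (d ≈? x ⊎-dec d ≈? y)
      ... | yes p | _ | _ | _ = ≈-trans (∙-congʳ p) (∙-congˡ (≈-sym p))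
      ... | no x≉y | no q | _ | _ = three-commute x∈ a∈ y∈ (λ p → q (inj₁ (≈-sym p))) x≉y (λ p → q (inj₂ p))
      ... | no x≉y | yes _ | no q | _ = three-commute x∈ b∈ y∈ (λ p → q (inj₁ (≈-sym p))) x≉y (λ p → q (inj₂ p))
      ... | no x≉y | yes _ | yes _ | no q = three-commute x∈ d∈ y∈ (λ p → q (inj₁ (≈-sym p))) x≉y (λ p → q (inj₂ p))
      ... | no _ | yes p | yes q | yes q′ = ⊥-elim (pigeonhole ab ad bd p q q′)
      only : r ∙ t ≈ t ∙ r → ∀ {w} → w ∈ OddElement → w ≈ r ⊎ w ≈ t
      only comm {w} (x , px , eq) with ⟨⟩-least (pair-isSubgroup rotation²) inj₂ px
        where
        rotation² : r ∙ t ∙ (r ∙ t) ≈ ε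
        rotation² = ≈-trans (∙-congˡ comm) (solve (invol r² ∷ invol t² ∷ []) (x₀ ⊙ x₁ ⊙ (x₁ ⊙ x₀)) one refl)
      ... | inj₁ x≈ε = inj₁ (≈-trans eq (≈-trans (∙-congʳ x≈ε) (identityˡ r)))
      ... | inj₂ x≈rt = inj₂ (≈-trans eq (≈-trans (∙-congʳ (≈-trans x≈rt comm))
        (solve (invol r² ∷ free t ∷ []) (x₁ ⊙ x₀ ⊙ x₀) x₁ refl)))

  record CanonicalPair (a b : Carrier) : Set (c ⊔ e) where
    field
      a∈T : a ∈ T
      b∈T : b ∈ T
      a≉b : ¬ a ≈ b
      canonical-a : ∀ p → p ∈ ⟨ Pair a b ⟩ → ν a p ≡ true → p ≈ a
      canonical-b : ∀ p → p ∈ ⟨ Pair a b ⟩ → ν b p ≡ true → p ≈ b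

  -- With no canonical generator r would be trivial, with only one r and t would both equal it, and
  -- a third is excluded by `at-most-two`.
  canonicalPair : ∀ {r t} → r ∈ T → t ∈ T → ¬ r ≈ t →
    ¬ ¬ (∃[ a ] ∃[ b ] (CanonicalPair a b × r ∈ ⟨ Pair a b ⟩ × t ∈ ⟨ Pair a b ⟩))
  canonicalPair {r} {t} rT tT r≉t =
    Can-generates H-sub rT (incl (first ≈-refl)) >>= λ r∈ →
    Can-generates H-sub tT (incl (second ≈-refl)) >>= λ t∈ →
    ¬¬-excluded-middle {A = ∃[ a ] a ∈ Can H} >>= one-generator r∈ t∈
    where
    open TwoReflections rT tT
    trivial : ∀ {w} → w ≈ ε ⊎ w ≈ ε → w ∈ T → ⊥
    trivial p wT = ε∉T (T-resp ([ (λ q → q) , (λ q → q) ]′ p) wT)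
    Result = ∃[ a ] ∃[ b ] (CanonicalPair a b × r ∈ ⟨ Pair a b ⟩ × t ∈ ⟨ Pair a b ⟩)
    module _ (r∈ : r ∈ ⟨ Can H ⟩) (t∈ : t ∈ ⟨ Can H ⟩) where
      two-generators : ∀ {a} → a ∈ Can H → Dec (∃[ b ] (b ∈ Can H × ¬ a ≈ b)) → ¬ ¬ Result
      two-generators {a} a∈ (no none) = ⊥-elim (r≉t (≈-trans (equals-a rT r∈) (≈-sym (equals-a tT t∈))))
        where
        equals-a : ∀ {w} → w ∈ T → w ∈ ⟨ Can H ⟩ → w ≈ a
        equals-a wT w∈ with ⟨⟩-least (pair-isSubgroup (T-involutive (proj₁ a∈)))
          (λ {x} x∈ → inj₂ (≈-sym (decidable-stable (a ≈? x) (λ ne → none (x , x∈ , ne))))) w∈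
        ... | inj₁ w≈ε = ⊥-elim (ε∉T (T-resp w≈ε wT))
        ... | inj₂ w≈a = w≈a
      two-generators {a} a∈ (yes (b , b∈ , a≉b)) = return
        (a , b , record
          { a∈T = proj₁ a∈ ; b∈T = proj₁ b∈ ; a≉b = a≉b
          ; canonical-a = λ p p∈ → proj₂ (proj₂ a∈) p (inside p∈)
          ; canonical-b = λ p p∈ → proj₂ (proj₂ b∈) p (inside p∈) }
        , covers r∈ , covers t∈)
        where
        inside : ⟨ Pair a b ⟩ ⊆ H
        inside = ⟨⟩-least H-sub λ where
          (first eq)  → resp (≈-sym eq) (proj₁ (proj₂ a∈))
          (second eq) → resp (≈-sym eq) (proj₁ (proj₂ b∈))
        covers : ⟨ Can H ⟩ ⊆ ⟨ Pair a b ⟩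
        covers = ⟨⟩-least (⟨⟩-isSubgroup _) cover
          where
          cover : Can H ⊆ ⟨ Pair a b ⟩
          cover {d} d∈ with a ≈? d | b ≈? d
          ... | yes p | _ = incl (first (≈-sym p))
          ... | no _ | yes p = incl (second (≈-sym p))
          ... | no p | no q = ⊥-elim (at-most-two a∈ b∈ d∈ a≉b p q)
      one-generator : Dec (∃[ a ] a ∈ Can H) → ¬ ¬ Result
      one-generator (yes (a , a∈)) = ¬¬-excluded-middle >>= two-generators a∈
      one-generator (no none) = ⊥-elim (trivial
        (⟨⟩-least (pair-isSubgroup (identityˡ ε)) (λ {x} x∈ → ⊥-elim (none (x , x∈))) r∈) rT)

-- Dihedral reflection subgroups and alternating words.

module DihedralSubgroups {c e : Level} (𝒲 : CoxeterSystem c e) (len : LengthFunction 𝒲) where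

  open CanonicalGenerators 𝒲 len public

  <⇒≉ : ∀ {u v} → ℓ u < ℓ v → ¬ u ≈ v
  <⇒≉ lt eq = ℕ.<-irrefl (ℓ-cong eq) lt

  ascend : ∀ {t u v} → t ∈ T → v ≈ t ∙ u → ν u t ≡ false → ℓ u < ℓ v
  ascend {u = u} tT eq νu = subst (ℓ u <_) (ℓ-cong (≈-sym eq)) (ν-false tT νu)

  ascend-<ᴮ : ∀ {t u v} → t ∈ T → v ≈ t ∙ u → ν u t ≡ false → u <ᴮ v
  ascend-<ᴮ tT eq νu = inj₂ [ _ , tT , eq , lt ] , <⇒≉ lt
    where lt = ascend tT eq νu

  X-resp : ∀ {p} {X : Pred Carrier p} → IsOrderIdeal X → ∀ {t t′} → t ≈ t′ → t ∈ X → t′ ∈ X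
  X-resp ideal eq tX = downClosed [ T-resp eq (⊆T tX) , ⊆T tX , inj₁ (≈-sym eq) ] tX
    where open IsOrderIdeal ideal

  -- The two canonical generators are coded by Booleans, so that `not` is passage to the other one.
  alt : ℕ → Bool → List Bool
  alt zero    d = []
  alt (suc k) d = d ∷ alt k (not d)

  -- Alternating words of odd length 2h + 1 are palindromes; these are the words of reflections.
  pal : ℕ → Bool → List Bool
  pal h d = alt (suc (h + h)) d

  flips : ℕ → Bool → Bool
  flips zero    d = d
  flips (suc k) d = flips k (not d)

  flips-double : ∀ k d → flips (k + k) d ≡ d
  flips-double zero    d = refl
  flips-double (suc k) d = trans (cong (λ l → flips l (not d)) (ℕ.+-suc k k))
    (trans (flips-double k _) (not-involutive d))

  alt-+ : ∀ k l d → alt (k + l) d ≡ alt k d ++ alt l (flips k d)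
  alt-+ zero    l d = refl
  alt-+ (suc k) l d = cong (d ∷_) (alt-+ k l (not d))

  pal-suc : ∀ h d → pal (suc h) d ≡ d ∷ (pal h (not d) ∷ʳ d)
  pal-suc h d = cong (d ∷_) (trans (cong (λ l → alt l (not d)) (trans (cong suc (ℕ.+-suc h h)) (ℕ.+-comm 1 (suc (h + h)))))
    (trans (alt-+ (suc (h + h)) 1 (not d))
      (cong (pal h (not d) ∷ʳ_) (trans (flips-double h _) (not-involutive d)))))

  pal-+ : ∀ j h d → pal (j + h) d ≡ alt (j + j) d ++ pal h d
  pal-+ j h d = trans (cong (λ l → alt l d) arith)
    (trans (alt-+ (j + j) _ d) (cong (λ d′ → alt (j + j) d ++ pal h d′) (flips-double j d)))
    where
    arith : suc (j + h + (j + h)) ≡ j + j + suc (h + h)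
    arith = trans (cong suc (interchange j h j h)) (sym (ℕ.+-suc (j + j) (h + h)))

  parity-alt : ∀ k d → parity (alt k d) ≡ true → ∃[ h ] k ≡ suc (h + h)
  parity-alt (suc zero)    d eq = 0 , refl
  parity-alt (suc (suc k)) d eq with parity-alt k _ (trans (sym (not-involutive _)) eq)
  ... | h , refl = suc h , cong suc (cong suc (sym (ℕ.+-suc h h)))

  either-letter : ∀ {a} {P : Pred Bool a} d → P d → P (not d) → ∀ i → P i
  either-letter true  p q true  = p
  either-letter true  p q false = q
  either-letter false p q true  = q
  either-letter false p q false = p

  module Dihedral {a b : Carrier} (P : CanonicalPair a b) where

    open CanonicalPair P

    H : Pred Carrier (c ⊔ e)
    H = ⟨ Pair a b ⟩

    H-sub : IsSubgroup H
    H-sub = ⟨⟩-isSubgroup (Pair a b)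

    open IsSubgroup H-sub public
    open Cosets H-sub public

    g : Bool → Carrier
    g true  = a
    g false = b

    g∈T : ∀ d → g d ∈ T
    g∈T true  = a∈T
    g∈T false = b∈T

    g∈H : ∀ d → g d ∈ H
    g∈H true  = incl (first ≈-refl)
    g∈H false = incl (second ≈-refl)

    g-canonical : ∀ d p → p ∈ H → ν (g d) p ≡ true → p ≈ g d
    g-canonical true  = canonical-a
    g-canonical false = canonical-b

    private module G = Words g H-sub g∈T g∈H g-canonical
    open G public hiding (reducedWord)

    g² : ∀ d → g d ∙ g d ≈ ε
    g² d = T-involutive (g∈T d)

    reducedWord : ∀ {w} → w ∈ H → ∃[ z ] (Reduced z × w ≈ ev z)
    reducedWord = G.reducedWord λ where
      (first p)  → true , p
      (second p) → false , p

    reduced-alternates : ∀ {i j z} → Reduced (i ∷ j ∷ z) → j ≡ not i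
    reduced-alternates {i} {j} red with i | j | reduced-ascent red | reduced-first (reduced-suffix (i ∷ []) red)
    ... | true  | false | _ | _ = refl
    ... | false | true  | _ | _ = refl
    ... | true  | true  | p | q with () ← trans (sym p) q
    ... | false | false | p | q with () ← trans (sym p) q

    reduced-alt : ∀ {i z} → Reduced (i ∷ z) → i ∷ z ≡ alt (length (i ∷ z)) i
    reduced-alt {i} {[]}    red = refl
    reduced-alt {i} {j ∷ z} red = cong (i ∷_) (trans (reduced-alt (reduced-suffix (i ∷ []) red))
      (cong (alt (length (j ∷ z))) (reduced-alternates red)))

    sign-ev : ∀ z → sign (ev z) ≡ parity z
    sign-ev []      = sign-ε
    sign-ev (d ∷ z) = trans (sign-∙ (g d) (ev z)) (cong₂ _xor_ (sign-T (g∈T d)) (sign-ev z))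

    -- A reduced word alternates, and the sign of a reflection makes its length odd.
    reduced-palindrome : ∀ {t d z} → t ∈ T → Reduced (d ∷ z) → t ≈ ev (d ∷ z) →
      ∃[ h ] (Reduced (pal h d) × t ≈ ev (pal h d))
    reduced-palindrome {t} {d} {z} tT red eq with parity-alt (length (d ∷ z)) d
      (trans (cong parity (sym (reduced-alt red)))
        (trans (sym (sign-ev (d ∷ z))) (trans (sign-cong (≈-sym eq)) (sign-T tT))))
    ... | h , len≡ = h , subst Reduced z≡ red , subst (λ y → t ≈ ev y) z≡ eq
      where
      z≡ : d ∷ z ≡ pal h d
      z≡ = trans (reduced-alt red) (cong (λ k → alt k d) len≡)

    palindrome : ∀ {t} → t ∈ T → t ∈ H → ∃[ h ] ∃[ d ] (Reduced (pal h d) × t ≈ ev (pal h d))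
    palindrome tT tH with reducedWord tH
    ... | [] , _ , eq = ⊥-elim (ε∉T (T-resp eq tT))
    ... | d ∷ z , red , eq with reduced-palindrome tT red eq
    ...   | h , red′ , eq′ = h , d , red′ , eq′

    -- Prescribing the first letter matters when t is the longest element of a finite H, since it
    -- then has reduced words starting with either letter. Such a word arises by prefixing d to a
    -- reduced word of `g d ∙ t`.
    palindrome-from : ∀ {t} d → t ∈ T → t ∈ H → ν t (g d) ≡ true →
      ∃[ h ] (Reduced (pal h d) × t ≈ ev (pal h d))
    palindrome-from {t} d tT tH νt with reducedWord (∙∈ (g∈H d) tH)
    ... | z , red , eq = reduced-palindrome tT
      (∷-reduced red (trans (ν-congˡ (≈-sym eq)) (trans (ν-∙ (g d) t (g d)) (cong₂ _xor_ (ν-self (g∈T d))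
        (trans (ν-congʳ (solve (free (g d) ∷ []) (x₀ ⁻ ⊙ x₀ ⊙ x₀) x₀ refl)) νt)))))
      (≈-trans (≈-sym (g-left d t)) (∙-congˡ eq))

    ev-pal-suc : ∀ h d → ev (pal (suc h) d) ≈ ev (pal h (not d)) ↑ g d
    ev-pal-suc h d = begin
      ev (pal (suc h) d)                ≡⟨ cong ev (pal-suc h d) ⟩
      g d ∙ ev (pal h (not d) ∷ʳ d)     ≈⟨ ∙-congˡ (ev-∷ʳ (pal h (not d)) d) ⟩
      g d ∙ (ev (pal h (not d)) ∙ g d)  ≈⟨ solve (invol (g² d) ∷ free (ev (pal h (not d))) ∷ [])
                                             (x₀ ⊙ (x₁ ⊙ x₀)) (x₀ ⁻ ⊙ x₁ ⊙ x₀) refl ⟩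
      ev (pal h (not d)) ↑ g d          ∎

    pal∈T : ∀ h d → ev (pal h d) ∈ T
    pal∈T zero    d = T-resp (≈-sym (identityʳ _)) (g∈T d)
    pal∈T (suc h) d = T-resp (≈-sym (ev-pal-suc h d)) (T-↑ (g d) (pal∈T h (not d)))

    pal-centre : ∀ h d → ∃[ m ] ev (pal h d) ≈ ev (alt h d) ∙ g m ∙ ev (alt h d) ⁻¹
    pal-centre zero    d = d , solve (free (g d) ∷ []) (x₀ ⊙ one) (one ⊙ x₀ ⊙ one ⁻) refl
    pal-centre (suc h) d with pal-centre h (not d)
    ... | m , eq = m , ≈-trans (ev-pal-suc h d) (≈-trans (↑-cong eq ≈-refl)
      (solve (invol (g² d) ∷ free (ev (alt h (not d))) ∷ free (g m) ∷ [])
        (x₀ ⁻ ⊙ (x₁ ⊙ x₂ ⊙ x₁ ⁻) ⊙ x₀) (x₀ ⊙ x₁ ⊙ x₂ ⊙ (x₀ ⊙ x₁) ⁻) refl))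

    -- Inversion number i, counted from 0, is obtained by reading the word up to its letter number i
    -- and back; conjugation by the first letter shifts i by one.
    inversions-alt : ∀ k d p → p ∈ H → ν (ev (alt k d)) p ≡ true → ∃[ i ] (i < k × p ≈ ev (pal i d))
    inversions-alt zero    d p p∈ eq with () ← trans (sym (ν-ε p)) eq
    inversions-alt (suc k) d p p∈ eq with ν (g d) p in eq₁
    ... | true = 0 , s≤s z≤n , ≈-trans (g-canonical d p p∈ eq₁) (≈-sym (identityʳ _))
    ... | false with inversions-alt k (not d) (p ↑ g d) (↑∈ (g∈H d) p∈)
                       (trans (cong (_xor ν (ev (alt k (not d))) (p ↑ g d)) (sym eq₁)) (trans (sym (ν-∙ (g d) _ p)) eq))
    ...   | i , i<k , eq₂ = suc i , s≤s i<k , (begin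
      p                         ≈⟨ solve (invol (g² d) ∷ free p ∷ []) x₁ (x₀ ⁻ ⊙ (x₀ ⁻ ⊙ x₁ ⊙ x₀) ⊙ x₀) refl ⟩
      p ↑ g d ↑ g d             ≈⟨ ↑-cong eq₂ ≈-refl ⟩
      ev (pal i (not d)) ↑ g d  ≈⟨ ev-pal-suc i d ⟨
      ev (pal (suc i) d)        ∎)

    -- The first letter of a reduced word of q is an inversion of q in H, so it is q.
    canonical-cases : ∀ {q} → q ∈ T → q ∈ H → (∀ p → p ∈ H → ν q p ≡ true → p ≈ q) → ∃[ d ] q ≈ g d
    canonical-cases qT qH can with reducedWord qH
    ... | [] , _ , eq = ⊥-elim (ε∉T (T-resp eq qT))
    ... | d ∷ z , red , eq = d , ≈-sym (can (g d) (g∈H d) (trans (ν-congˡ eq) (reduced-first red)))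

    Pair⊆T : Pair a b ⊆ T
    Pair⊆T (first eq)  = T-resp (≈-sym eq) a∈T
    Pair⊆T (second eq) = T-resp (≈-sym eq) b∈T

    isDihedral : IsDihedral H
    isDihedral = a , b , a≉b , generator true , generator false , only
      where
      generator : ∀ d → g d ∈ CanonicalGenerator H
      generator d = g∈T d , λ r → mk⇔
        (λ where ((rT , lt) , rH) → g-canonical d r rH (<⇒ν-true rT lt))
        (λ eq → (T-resp (≈-sym eq) (g∈T d) , ν-true (trans (ν-congʳ eq) (ν-self (g∈T d)))) , resp (≈-sym eq) (g∈H d))
      only : ∀ t → t ∈ CanonicalGenerator H → t ≈ a ⊎ t ≈ b
      only t (tT , can) with canonical-cases tT (proj₂ (Equivalence.from (can t) ≈-refl)) canonical
        where
        canonical : ∀ p → p ∈ H → ν t p ≡ true → p ≈ t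
        canonical p pH νt = Equivalence.to (can p) ((ν⇒T νt , ν-true νt) , pH)
      ... | true  , eq = inj₁ eq
      ... | false , eq = inj₂ eq

    arrow : ∀ {t u v} → t ∈ T → u ∈ H → v ∈ H → v ≈ t ∙ u → ν u t ≡ false → ArrowIn H u v
    arrow {t} {u} {v} tT uH vH eq νu = uH , vH , T-resp (begin
      t             ≈⟨ T-⁻¹ tT ⟨
      t ⁻¹          ≈⟨ solve (free t ∷ free u ∷ []) (x₀ ⁻) (x₁ ⊙ (x₀ ⊙ x₁) ⁻) refl ⟩
      u ∙ (t ∙ u) ⁻¹  ≈⟨ ∙-congˡ (⁻¹-cong eq) ⟨
      u ∙ v ⁻¹      ∎) tT , ascend-<ᴮ tT eq νu

    left-path : ∀ x {y} → Reduced (x ++ y) → Star (ArrowIn H) (ev y) (ev (x ++ y))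
    left-path []      red = done
    left-path (i ∷ x) {y} red = left-path x (reduced-suffix (i ∷ []) red) ◅◅
      (arrow (g∈T i) (ev∈H (x ++ y)) (ev∈H (i ∷ x ++ y)) ≈-refl (reduced-ascent red) ◅ done)

    -- Right multiplication by a generator is left multiplication by one of its conjugates, again a
    -- reflection.
    right-arrow : ∀ {z i} → Reduced (z ∷ʳ i) → ArrowIn H (ev z) (ev (z ∷ʳ i))
    right-arrow {z} {i} red = arrow (T-↑ (ev z ⁻¹) (g∈T i)) (ev∈H z) (ev∈H (z ∷ʳ i))
      (≈-trans (ev-∷ʳ z i) (solve (free (ev z) ∷ free (g i) ∷ []) (x₀ ⊙ x₁) (x₀ ⁻ ⁻ ⊙ x₁ ⊙ x₀ ⁻ ⊙ x₀) refl))
      (trans (sym (ν-⁻¹ (ev z) (g i))) (reduced-∷ʳ red))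

    path⇒⊑ : ∀ {t t′} → t ∈ T → t′ ∈ T → t ∈ H → t′ ∈ H → Star (ArrowIn H) t t′ → t ⊑ t′
    path⇒⊑ tT t′T tH t′H path = [ tT , t′T , inj₂ (Pair a b , Pair⊆T , isDihedral , tH , t′H , path) ]

    -- Consequences of down-closure inside a dihedral subgroup.

    module Ideal {p} {X : Pred Carrier p} (ideal : IsOrderIdeal X) where

      open IsOrderIdeal ideal

      -- Palindromes with the same first letter differ by an even number of letters, so the shorter
      -- is a suffix of the longer; prepending the missing letters is an ascending path in H.
      pal-suffix∈X : ∀ {i h d} → i ≤ h → Reduced (pal h d) → ev (pal h d) ∈ X → ev (pal i d) ∈ X
      pal-suffix∈X {i} {h} {d} i≤h red tX with ℕ.m≤n⇒∃[o]m+o≡n i≤h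
      ... | j , refl = downClosed (path⇒⊑ (pal∈T i d) (pal∈T (i + j) d) (ev∈H (pal i d)) (ev∈H (pal (i + j) d))
        (subst (λ z → Star (ArrowIn H) (ev (pal i d)) (ev z)) (sym split) (left-path (alt (j + j) d) (subst Reduced split red)))) tX
        where
        split : pal (i + j) d ≡ alt (j + j) d ++ pal i d
        split = trans (cong (λ k → pal k d) (ℕ.+-comm i j)) (pal-+ j i d)

      pal-core-reduced : ∀ {h d} → Reduced (pal (suc h) d) → Reduced (pal h (not d))
      pal-core-reduced {h} {d} red = reduced-prefix (d ∷ []) (reduced-suffix (d ∷ []) (subst Reduced (pal-suc h d) red))

      -- The path appends the last letter and then prepends the first. Its middle vertex is no
      -- reflection, but paths in the Bruhat graph of H may pass through any element of H.
      pal-core∈X : ∀ {h d} → Reduced (pal (suc h) d) → ev (pal (suc h) d) ∈ X → ev (pal h (not d)) ∈ X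
      pal-core∈X {h} {d} red tX = downClosed
        (path⇒⊑ (pal∈T h (not d)) (pal∈T (suc h) d) (ev∈H (pal h (not d))) (ev∈H (pal (suc h) d))
          (right-arrow {pal h (not d)} (reduced-suffix (d ∷ []) red′) ◅ subst (λ z → Star (ArrowIn H) (ev (pal h (not d) ∷ʳ d)) (ev z))
            (sym (pal-suc h d)) (left-path (d ∷ []) red′))) tX
        where
        red′ = subst Reduced (pal-suc h d) red

      -- The palindrome of t has at least three letters: one generator is its last letter, the other
      -- is the last letter of its core.
      generators∈X : ∀ {t} → t ∈ X → t ∈ H → (∀ d → ¬ t ≈ g d) → ∀ d → g d ∈ X
      generators∈X tX tH t≉g with palindrome (⊆T tX) tH
      ... | zero , d , _ , eq = ⊥-elim (t≉g d (≈-trans eq (identityʳ _)))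
      ... | suc h , d , red , eq = either-letter d first-letter second-letter
        where
        pX : ev (pal (suc h) d) ∈ X
        pX = X-resp ideal eq tX
        first-letter : g d ∈ X
        first-letter = X-resp ideal (identityʳ _) (pal-suffix∈X {0} {suc h} z≤n red pX)
        second-letter : g (not d) ∈ X
        second-letter = X-resp ideal (identityʳ _)
          (pal-suffix∈X {0} {h} z≤n (pal-core-reduced {h} red) (pal-core∈X {h} red pX))

      -- Write t = p m p⁻¹ with m the middle letter of its palindrome; then
      -- N t ∩ H consists of t, of N p ∩ H and of t (N p ∩ H) t.
      inversion∈X : ∀ {t r} → t ∈ X → t ∈ H → r ∈ H → ¬ r ≈ t → ν t r ≡ true → r ∈ X ⊎ r ↑ t ∈ X
      inversion∈X {t} {r} tX tH rH r≉t νt with palindrome (⊆T tX) tH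
      ... | h , d , red , eq with pal-centre h d
      ...   | m , eq′ = [ (λ νp → inj₁ (initial rH νp)) , (λ νp → inj₂ (initial (↑∈ tH rH) νp)) ]′
                          (either (trans (sym expand) νt))
        where
        q = ev (alt h d)
        t≈ : t ≈ q ∙ g m ∙ q ⁻¹
        t≈ = ≈-trans eq eq′
        initial : ∀ {p} → p ∈ H → ν q p ≡ true → p ∈ X
        initial pH νq with inversions-alt h d _ pH νq
        ... | i , i<h , p≈ = X-resp ideal (≈-sym p≈) (pal-suffix∈X (ℕ.<⇒≤ i<h) red (X-resp ideal eq tX))
        middle : ν (g m) (r ↑ q) ≡ false
        middle with ν (g m) (r ↑ q) in νm
        ... | false = refl
        ... | true  = ⊥-elim (r≉t (begin
          r               ≈⟨ ↑-move (g-canonical m _ (↑∈ (ev∈H (alt h d)) rH) νm) ⟩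
          g m ↑ q ⁻¹      ≈⟨ solve (free (g m) ∷ free q ∷ []) (x₁ ⁻ ⁻ ⊙ x₀ ⊙ x₁ ⁻) (x₁ ⊙ x₀ ⊙ x₁ ⁻) refl ⟩
          q ∙ g m ∙ q ⁻¹  ≈⟨ t≈ ⟨
          t               ∎))
        expand : ν t r ≡ (ν q r xor false) xor ν q (r ↑ t)
        expand = trans (ν-congˡ t≈) (trans (ν-∙ (q ∙ g m) (q ⁻¹) r) (cong₂ _xor_
          (trans (ν-∙ q (g m) r) (cong (ν q r xor_) middle))
          (trans (ν-⁻¹ q _) (ν-congʳ (≈-trans (↑-∙ r _ _) (↑-cong ≈-refl (≈-sym t≈)))))))
        either : ∀ {x y} → (x xor false) xor y ≡ true → x ≡ true ⊎ y ≡ true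
        either {true}         _ = inj₁ refl
        either {false} {true} _ = inj₂ refl

-- Length gaps and cosets of dihedral subgroups.

module Gaps {c e : Level} (𝒲 : CoxeterSystem c e) (len : LengthFunction 𝒲) where

  open DihedralSubgroups 𝒲 len public

  ↑⁻¹-∙ : ∀ t x y → t ↑ (x ∙ y) ⁻¹ ≈ t ↑ y ⁻¹ ↑ x ⁻¹
  ↑⁻¹-∙ t x y = solve (free t ∷ free x ∷ free y ∷ [])
    ((x₁ ⊙ x₂) ⁻ ⁻ ⊙ x₀ ⊙ (x₁ ⊙ x₂) ⁻) (x₁ ⁻ ⁻ ⊙ (x₂ ⁻ ⁻ ⊙ x₀ ⊙ x₂ ⁻) ⊙ x₁ ⁻) refl

  ↑⁻¹-∙ˡ : ∀ t x → (t ↑ x ⁻¹) ∙ x ≈ x ∙ t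
  ↑⁻¹-∙ˡ t x = solve (free t ∷ free x ∷ []) (x₁ ⁻ ⁻ ⊙ x₀ ⊙ x₁ ⁻ ⊙ x₁) (x₁ ⊙ x₀) refl

  -- Right descents are expressed as inversions of the inverse, here and below.
  right-descent-flips : ∀ {t} → t ∈ T → ∀ u → ν ((u ∙ t) ⁻¹) t ≡ not (ν (u ⁻¹) t)
  right-descent-flips {t} tT u = trans (ν-congˡ eq) (trans (ν-∙ t (u ⁻¹) t) (cong₂ _xor_ (ν-self tT)
    (ν-congʳ (solve (free t ∷ []) (x₀ ⁻ ⊙ x₀ ⊙ x₀) x₀ refl))))
    where
    eq : (u ∙ t) ⁻¹ ≈ t ∙ u ⁻¹
    eq = solve (invol (T-involutive tT) ∷ free u ∷ []) ((x₁ ⊙ x₀) ⁻) (x₀ ⊙ x₁ ⁻) refl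

  module CosetShapes {a b : Carrier} (P : CanonicalPair a b) where

    open Dihedral P

    -- The position of w and t w in the dihedral subgroup, when some element
    -- lies strictly between them: either w < w d < t w d < t w for a canonical
    -- generator d, or w lies at least two steps below t w in the left weak order.
    data Shape (t w : Carrier) : Set (c ⊔ e) where
      switch : ∀ d → ν (w ⁻¹) (g d) ≡ false → ν ((t ∙ w) ⁻¹) (g d) ≡ true →
               ν w t ≡ false → ¬ t ≈ g d ↑ w ⁻¹ → Shape t w
      weak   : ∀ z₁ z → w ≈ ev z → t ∙ w ≈ ev (z₁ ++ z) → Reduced (z₁ ++ z) →
               2 ≤ length z₁ → (∀ d → ¬ t ≈ g d) → Shape t w

    -- By the cocycle, the right descent of t w at `g d` comes either from t at the reflection
    -- `g d ↑ w ⁻¹` or from a right descent of w, and the latter is excluded.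
    switch-inversion : ∀ {t w d} → t ∈ T → ν (w ⁻¹) (g d) ≡ false → ν ((t ∙ w) ⁻¹) (g d) ≡ true →
      ν t (g d ↑ w ⁻¹) ≡ true
    switch-inversion {t} {w} {d} tT asc desc = trans (sym expand) desc
      where
      r = g d ↑ w ⁻¹
      expand : ν ((t ∙ w) ⁻¹) (g d) ≡ ν t r
      expand = trans (ν-⁻¹ (t ∙ w) (g d)) (trans (ν-congʳ (↑⁻¹-∙ (g d) t w)) (trans (ν-∙ t w (r ↑ t ⁻¹))
        (trans (cong₂ _xor_
          (trans (sym (ν-⁻¹ t r)) (ν-congˡ (T-⁻¹ tT)))
          (trans (ν-congʳ (↑-cancel r t)) (trans (sym (ν-⁻¹ w (g d))) asc))) (xor-identityʳ _))))

    right-multiplication : ∀ {x w u i} → Bottom H x → w ∈ H → u ≈ w ∙ x → s i ↑ x ⁻¹ ∈ H →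
      ν (u ⁻¹) (s i) ≡ ν (w ⁻¹) (s i ↑ x ⁻¹)
    right-multiplication {x} {w} {u} {i} bot wH eq qH = trans (ν-congˡ (⁻¹-cong eq)) (trans (ν-⁻¹ (w ∙ x) (s i))
      (trans (ν-congʳ (↑⁻¹-∙ (s i) w x)) (trans (ν-coset bot wH (↑⁻¹∈ wH qH)) (sym (ν-⁻¹ w _)))))

    -- Let q be the conjugate, so that q x = x s. As x has no inversions in H, those of q in H are
    -- those of x s, and they come from the single inversion of s.
    simple-acts-as-generator : ∀ {x} i → Bottom H x → s i ↑ x ⁻¹ ∈ H → ∃[ d ] s i ↑ x ⁻¹ ≈ g d
    simple-acts-as-generator {x} i bot qH = canonical-cases (T-↑ (x ⁻¹) (s∈T i)) qH λ p pH νq →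
      ↑-move (s-canonical i (p ↑ x) (trans (sym (expand p pH)) νq))
      where
      expand : ∀ p → p ∈ H → ν (s i ↑ x ⁻¹) p ≡ ν (s i) (p ↑ x)
      expand p pH = trans (sym (ν-coset bot qH pH)) (trans (ν-congˡ (↑⁻¹-∙ˡ (s i) x))
        (trans (ν-∙ x (s i) p) (cong (_xor ν (s i) (p ↑ x)) (bot p pH))))

    shape-step : ∀ {t w} → t ∈ T → t ∈ H → w ∈ H → Shape t w → ∀ d →
      ν (w ⁻¹) (g d) ≡ false → ν ((t ∙ w) ⁻¹) (g d) ≡ false → Shape t (w ∙ g d)
    shape-step {t} {w} tT tH wH (switch d₀ asc desc _ t≉) = either-letter d₀ absurd other
      where
      absurd : ν (w ⁻¹) (g d₀) ≡ false → ν ((t ∙ w) ⁻¹) (g d₀) ≡ false → Shape t (w ∙ g d₀)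
      absurd _ desc′ with () ← trans (sym desc) desc′
      -- A generator has no inversion in H but itself, whereas t has the inversion `g d₀ ↑ w ⁻¹`,
      -- which differs from t.
      t≉g : ∀ d → ¬ t ≈ g d
      t≉g d eq = t≉ (≈-trans eq (≈-sym (g-canonical d _ (↑⁻¹∈ wH (g∈H d₀))
        (trans (ν-congˡ (≈-sym eq)) (switch-inversion {w = w} {d₀} tT asc desc)))))
      trivial : (∀ d → ν (w ⁻¹) (g d) ≡ false) → w ≈ ε
      trivial asc with reducedWord (⁻¹∈ wH)
      ... | [] , _ , eq = begin
        w         ≈⟨ solve (free w ∷ []) x₀ (x₀ ⁻ ⁻) refl ⟩
        w ⁻¹ ⁻¹   ≈⟨ ⁻¹-cong eq ⟩
        ε ⁻¹      ≈⟨ ε⁻¹≈ε ⟩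
        ε         ∎
      ... | d ∷ z , red , eq with () ← trans (sym (asc d)) (trans (ν-congˡ eq) (reduced-first red))
      long : ∀ z → t ≈ ev z → 2 ≤ length z
      long []          eq = ⊥-elim (ε∉T (T-resp eq tT))
      long (d ∷ [])    eq = ⊥-elim (t≉g d (≈-trans eq (identityʳ _)))
      long (_ ∷ _ ∷ _) eq = s≤s (s≤s z≤n)
      other : ν (w ⁻¹) (g (not d₀)) ≡ false → ν ((t ∙ w) ⁻¹) (g (not d₀)) ≡ false → Shape t (w ∙ g (not d₀))
      -- With neither generator a right descent, w is trivial. For the generator g other than `g d₀`
      -- the new pair is g and t g, and a reduced word of t supplies at least two letters because t
      -- is not a generator.
      other asc′ asc″ with reducedWord tH
      ... | z , red , eq = weak z (not d₀ ∷ []) (≈-trans (∙-congʳ w≈ε) (≈-trans (identityˡ _) (≈-sym (identityʳ _))))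
        (begin
          t ∙ (w ∙ g (not d₀))   ≈⟨ ∙-cong eq (≈-trans (∙-congʳ w≈ε) (identityˡ _)) ⟩
          ev z ∙ g (not d₀)      ≈⟨ ev-∷ʳ z (not d₀) ⟨
          ev (z ∷ʳ not d₀)       ∎)
        (∷ʳ-reduced red (trans (ν-congˡ (⁻¹-cong (begin
          ev z    ≈⟨ eq ⟨
          t       ≈⟨ identityʳ t ⟨
          t ∙ ε   ≈⟨ ∙-congˡ w≈ε ⟨
          t ∙ w   ∎))) asc″))
        (long z eq) t≉g
        where
        w≈ε : w ≈ ε
        w≈ε = trivial (either-letter d₀ asc asc′)
    shape-step {t} {w} tT tH wH (weak z₁ z w≈ tw≈ red long t≉g) d _ asc = weak z₁ (z ∷ʳ d)
      (≈-trans (∙-congʳ w≈) (≈-sym (ev-∷ʳ z d)))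
      (begin
        t ∙ (w ∙ g d)           ≈⟨ assoc t w (g d) ⟨
        t ∙ w ∙ g d             ≈⟨ ∙-congʳ tw≈ ⟩
        ev (z₁ ++ z) ∙ g d      ≈⟨ ev-∷ʳ (z₁ ++ z) d ⟨
        ev ((z₁ ++ z) ∷ʳ d)     ≡⟨ cong ev (List.++-assoc z₁ z (d ∷ [])) ⟩
        ev (z₁ ++ z ∷ʳ d)       ∎)
      (subst Reduced (List.++-assoc z₁ z (d ∷ [])) (∷ʳ-reduced red (trans (ν-congˡ (⁻¹-cong (≈-sym tw≈))) asc)))
      long t≉g

  record Gap (t u : Carrier) : Set (c ⊔ e) where
    field
      {a b} : Carrier
      pair : CanonicalPair a b
    open Dihedral pair using (H)
    open CosetShapes pair using (Shape)
    field
      t∈H    : t ∈ H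
      x w    : Carrier
      w∈H    : w ∈ H
      u≈wx   : u ≈ w ∙ x
      bottom : Bottom H x
      shape  : Shape t w

  gap-resp : ∀ {t u u′} → u ≈ u′ → Gap t u → Gap t u′
  gap-resp eq G = record { Gap G hiding (u≈wx) ; u≈wx = ≈-trans (≈-sym eq) (Gap.u≈wx G) }

  gap-step : ∀ {t u} i → t ∈ T → Gap t u → ν (u ⁻¹) (s i) ≡ false → ν ((t ∙ u) ⁻¹) (s i) ≡ false →
    ¬ ¬ Gap t (u ∙ s i)
  gap-step {t} {u} i tT G asc asc′ = ¬¬-excluded-middle >>= λ d → return (by d)
    where
    open Gap G
    open Dihedral pair
    open CosetShapes pair
    q = s i ↑ x ⁻¹
    by : Dec (q ∈ H) → Gap t (u ∙ s i)
    by (no q∉H) = record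
      { pair = pair ; t∈H = t∈H ; x = x ∙ s i ; w = w ; w∈H = w∈H
      ; u≈wx = ≈-trans (∙-congʳ u≈wx) (assoc _ _ _)
      ; bottom = λ p pH → trans (ν-∙ x (s i) p) (cong₂ _xor_ (bottom p pH) (avoids p pH))
      ; shape = shape }
      where
      -- The only inversion that x gains on passing to `x ∙ s i` is q, which lies outside H.
      avoids : ∀ p → p ∈ H → ν (s i) (p ↑ x) ≡ false
      avoids p pH with ν (s i) (p ↑ x) in eq
      ... | false = refl
      ... | true  = ⊥-elim (q∉H (resp (↑-move (s-canonical i _ eq)) pH))
    by (yes q∈H) with simple-acts-as-generator i bottom q∈H
    ... | d , q≈ = record
      { pair = pair ; t∈H = t∈H ; x = x ; w = w ∙ g d ; w∈H = ∙∈ w∈H (g∈H d)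
      ; u≈wx = begin
          u ∙ s i            ≈⟨ ∙-congʳ u≈wx ⟩
          w ∙ x ∙ s i        ≈⟨ assoc w x (s i) ⟩
          w ∙ (x ∙ s i)      ≈⟨ ∙-congˡ (↑⁻¹-∙ˡ (s i) x) ⟨
          w ∙ (q ∙ x)        ≈⟨ ∙-congˡ (∙-congʳ q≈) ⟩
          w ∙ (g d ∙ x)      ≈⟨ assoc w (g d) x ⟨
          w ∙ g d ∙ x        ∎
      ; bottom = bottom
      ; shape = shape-step tT t∈H w∈H shape d
          (trans (ν-congʳ (≈-sym q≈)) (trans (sym (right-multiplication bottom w∈H u≈wx q∈H)) asc))
          (trans (ν-congʳ (≈-sym q≈)) (trans (sym (right-multiplication bottom (∙∈ t∈H w∈H)
            (≈-trans (∙-congˡ u≈wx) (≈-sym (assoc t w x))) q∈H)) asc′)) }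

  gap-base : ∀ {t u} i → t ∈ T → ν (u ⁻¹) (s i) ≡ false → ν ((t ∙ u) ⁻¹) (s i) ≡ true →
    ν u t ≡ false → ¬ t ≈ s i ↑ u ⁻¹ → ¬ ¬ Gap t u
  gap-base {t} {u} i tT asc desc νu t≉ =
    canonicalPair (T-↑ (u ⁻¹) (s∈T i)) tT (λ eq → t≉ (≈-sym eq)) >>= λ (a , b , P , r∈H , t∈H) →
    Dihedral.bottom-exists P u >>= λ (x , w , w∈H , u≈wx , bottom) →
    return (build P r∈H t∈H w∈H u≈wx bottom)
    where
    module _ {a b} (P : CanonicalPair a b) where
      open Dihedral P
      open CosetShapes P
      build : s i ↑ u ⁻¹ ∈ H → t ∈ H → ∀ {x w} → w ∈ H → u ≈ w ∙ x → Bottom H x → Gap t u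
      build r∈H t∈H {x} {w} w∈H u≈wx bottom with simple-acts-as-generator i bottom q∈H
        where
        q∈H : s i ↑ x ⁻¹ ∈ H
        q∈H = resp (begin
          s i ↑ u ⁻¹ ↑ w            ≈⟨ ↑-cong (↑-cong ≈-refl (⁻¹-cong u≈wx)) ≈-refl ⟩
          s i ↑ (w ∙ x) ⁻¹ ↑ w      ≈⟨ ↑-cong (↑⁻¹-∙ (s i) w x) ≈-refl ⟩
          s i ↑ x ⁻¹ ↑ w ⁻¹ ↑ w     ≈⟨ ↑-cancel _ w ⟩
          s i ↑ x ⁻¹                ∎) (↑∈ w∈H r∈H)
      ... | d , q≈ = record
        { pair = P ; t∈H = t∈H ; x = x ; w = w ; w∈H = w∈H ; u≈wx = u≈wx ; bottom = bottom
        ; shape = switch d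
            (trans (ν-congʳ (≈-sym q≈)) (trans (sym (right-multiplication bottom w∈H u≈wx q∈H)) asc))
            (trans (ν-congʳ (≈-sym q≈)) (trans (sym (right-multiplication bottom (∙∈ t∈H w∈H)
              (≈-trans (∙-congˡ u≈wx) (≈-sym (assoc t w x))) q∈H)) desc))
            (trans (sym (ν-coset bottom w∈H t∈H)) (trans (ν-congˡ (≈-sym u≈wx)) νu))
            (λ eq → t≉ (begin
              t                         ≈⟨ eq ⟩
              g d ↑ w ⁻¹                ≈⟨ ↑-cong q≈ ≈-refl ⟨
              s i ↑ x ⁻¹ ↑ w ⁻¹         ≈⟨ ↑⁻¹-∙ (s i) w x ⟨
              s i ↑ (w ∙ x) ⁻¹          ≈⟨ ↑-cong ≈-refl (⁻¹-cong u≈wx) ⟨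
              s i ↑ u ⁻¹                ∎)) }
        where
        q∈H : s i ↑ x ⁻¹ ∈ H
        q∈H = resp (≈-sym q≈) (g∈H d)

  ℓ-∙s : ∀ u i → ℓ (u ∙ s i) ≤ suc (ℓ u)
  ℓ-∙s u i with attained u
  ... | x , ev , l = subst (ℓ (u ∙ s i) ≤_) (trans (List.length-++ x) (trans (ℕ.+-comm _ 1) (cong suc l)))
    (minimal _ (x ∷ʳ i) (≈-trans (eval-++ x (i ∷ [])) (∙-cong ev (identityʳ _))))

  right-descent : ∀ u i → ν (u ⁻¹) (s i) ≡ true → ℓ (u ∙ s i) < ℓ u
  right-descent u i νu = subst (_< ℓ u) (ℓ-cong (↑⁻¹-∙ˡ (s i) u)) (ν-true (trans (sym (ν-⁻¹ u (s i))) νu))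

  left-descent-exists : ∀ u → ¬ u ≈ ε → ∃[ i ] ν u (s i) ≡ true
  left-descent-exists u u≉ε with attained u
  ... | [] , ev , _ = ⊥-elim (u≉ε (≈-sym ev))
  ... | i ∷ x , ev , l = i , <⇒ν-true (s∈T i) (subst (ℓ (s i ∙ u) <_) l
    (s≤s (minimal _ x (begin
      eval x                  ≈⟨ solve (invol (s-involutive i) ∷ free (eval x) ∷ []) x₁ (x₀ ⊙ (x₀ ⊙ x₁)) refl ⟩
      s i ∙ (s i ∙ eval x)    ≈⟨ ∙-congˡ ev ⟩
      s i ∙ u                 ∎))))

  gap-exists : ∀ {t} → t ∈ T → ∀ u → 2 + ℓ u ≤ ℓ (t ∙ u) → ¬ ¬ Gap t u
  gap-exists {t} tT u = go (suc (ℓ u)) u ℕ.≤-refl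
    where
    go : ∀ k u → ℓ u < k → 2 + ℓ u ≤ ℓ (t ∙ u) → ¬ ¬ Gap t u
    go (suc k) u (s≤s u≤k) far with left-descent-exists ((t ∙ u) ⁻¹) nontrivial
      where
      nontrivial : ¬ (t ∙ u) ⁻¹ ≈ ε
      nontrivial eq = ℕ.n≮0 (ℕ.≤-trans far (minimal _ [] (begin
        ε              ≈⟨ ε⁻¹≈ε ⟨
        ε ⁻¹           ≈⟨ ⁻¹-cong eq ⟨
        (t ∙ u) ⁻¹ ⁻¹  ≈⟨ solve (free (t ∙ u) ∷ []) (x₀ ⁻ ⁻) x₀ refl ⟩
        t ∙ u          ∎)))
    ... | i , desc with ν (u ⁻¹) (s i) in νu
    -- If t were `s i ↑ u ⁻¹`, then t u would be u s, too short for the assumed gap.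
    ...   | false = gap-base i tT νu desc (<⇒ν-false (ℕ.≤-trans (ℕ.n≤1+n _) far)) λ eq →
      ℕ.<-irrefl refl (ℕ.≤-trans far (subst (_≤ suc (ℓ u)) (ℓ-cong (begin
        u ∙ s i              ≈⟨ ↑⁻¹-∙ˡ (s i) u ⟨
        (s i ↑ u ⁻¹) ∙ u     ≈⟨ ∙-congʳ eq ⟨
        t ∙ u                ∎)) (ℓ-∙s u i)))
    ...   | true = go k (u ∙ s i) (ℕ.<-≤-trans (right-descent u i νu) u≤k) far′ >>= λ G →
      gap-step i tT G (trans (right-descent-flips (s∈T i) u) (cong not νu))
        (trans (ν-congˡ (⁻¹-cong (≈-sym (assoc t u (s i))))) (trans (right-descent-flips (s∈T i) (t ∙ u)) (cong not desc)))
      >>= λ G′ → return (gap-resp (undo u) G′)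
      where
      undo : ∀ u → u ∙ s i ∙ s i ≈ u
      undo u = solve (free u ∷ invol (s-involutive i) ∷ []) (x₀ ⊙ x₁ ⊙ x₁) x₀ refl
      -- Stripping `s i` takes at least one off the length of u and at most one off that of t u.
      far′ : 2 + ℓ (u ∙ s i) ≤ ℓ (t ∙ (u ∙ s i))
      far′ = s≤s⁻¹ (ℕ.≤-trans (s≤s (s≤s (right-descent u i νu))) (ℕ.≤-trans far
        (subst₂ _≤_ (ℓ-cong (undo (t ∙ u))) (cong suc (ℓ-cong (assoc t u (s i)))) (ℓ-∙s (t ∙ u ∙ s i) i))))

-- Interior elements of intervals in the L^X-order.

module OrderIdeals {c e : Level} (𝒲 : CoxeterSystem c e) (len : LengthFunction 𝒲) where

  open Gaps 𝒲 len public

  module OrderIdeal {p} {X : Pred Carrier p} (ideal : IsOrderIdeal X) where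

    open IsOrderIdeal ideal

    infix 4 _⊏_

    _⊏_ : Carrier → Carrier → Set (c ⊔ e ⊔ p)
    u ⊏ v = ℓ u < ℓ v × TransClosure (LStep X) u v

    ⊏-trans : ∀ {u v w} → u ⊏ v → v ⊏ w → u ⊏ w
    ⊏-trans (lt , xs) (lt′ , ys) = ℕ.<-trans lt lt′ , xs ++⁺ ys

    ⊏-resp : ∀ {u u′ v v′} → u ≈ u′ → v ≈ v′ → u ⊏ v → u′ ⊏ v′
    ⊏-resp p q (lt , xs) = subst₂ _<_ (ℓ-cong p) (ℓ-cong q) lt ,
      ⁺-respˡ (LStep-respˡ X) p (⁺-respʳ (LStep-respʳ X) q xs)

    ascent⊏ : ∀ {r u v} → r ∈ X → v ≈ r ∙ u → ν u r ≡ false → u ⊏ v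
    ascent⊏ rX eq νu = ascend (⊆T rX) eq νu , [ _ , rX , eq , ascend-<ᴮ (⊆T rX) eq νu ]

    module _ {a b : Carrier} (P : CanonicalPair a b) where

      open Dihedral P
      open CosetShapes P
      open Ideal ideal

      suffix-ℓ≤ : ∀ z₁ z → Reduced (z₁ ++ z) → ℓ (ev z) ≤ ℓ (ev (z₁ ++ z))
      suffix-ℓ≤ []       z red = ℕ.≤-refl
      suffix-ℓ≤ (d ∷ z₁) z red = ℕ.≤-trans (suffix-ℓ≤ z₁ z (reduced-suffix (d ∷ []) red))
        (ℕ.<⇒≤ (ν-false (g∈T d) (reduced-ascent red)))

      letter⊏ : ∀ {x d} z → g d ∈ X → Bottom H x → Reduced (d ∷ z) → ev z ∙ x ⊏ ev (d ∷ z) ∙ x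
      letter⊏ {x} {d} z gX bot red = ascent⊏ gX (assoc (g d) (ev z) x)
        (trans (ν-coset bot (ev∈H z) (g∈H d)) (reduced-ascent red))

      suffix⊏ : ∀ {x} → (∀ d → g d ∈ X) → Bottom H x → ∀ z₁ z → 1 ≤ length z₁ → Reduced (z₁ ++ z) →
        ev z ∙ x ⊏ ev (z₁ ++ z) ∙ x
      suffix⊏ gX bot (d ∷ [])      z _ red = letter⊏ z (gX d) bot red
      suffix⊏ gX bot (d ∷ d′ ∷ z₁) z _ red = ⊏-trans
        (suffix⊏ gX bot (d′ ∷ z₁) z (s≤s z≤n) (reduced-suffix (d ∷ []) red))
        (letter⊏ (d′ ∷ z₁ ++ z) (gX d) bot red)

      -- A reduced word of w⁻¹ cannot start with d, so it is empty, the case `k = 0`, or alternates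
      -- from `not d` on.
      alt-ending : ∀ {w} d → w ∈ H → ν (w ⁻¹) (g d) ≡ false →
        ∃[ k ] (Reduced (reverse (alt k (not d))) × w ≈ ev (reverse (alt k (not d))))
      alt-ending {w} d wH asc with reducedWord (⁻¹∈ wH)
      ... | z , red , eq = length z , subst Reduced (cong reverse (shape z red eq)) (reduced-reverse red) , (begin
        w                   ≈⟨ solve (free w ∷ []) x₀ (x₀ ⁻ ⁻) refl ⟩
        w ⁻¹ ⁻¹             ≈⟨ ⁻¹-cong eq ⟩
        ev z ⁻¹             ≈⟨ ev-reverse z ⟨
        ev (reverse z)      ≡⟨ cong (λ y → ev (reverse y)) (shape z red eq) ⟩
        ev (reverse (alt (length z) (not d))) ∎)
        where
        shape : ∀ z → Reduced z → w ⁻¹ ≈ ev z → z ≡ alt (length z) (not d)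
        shape []      red eq = refl
        shape (i ∷ z) red eq = either-letter {P = λ i → Reduced (i ∷ z) → w ⁻¹ ≈ ev (i ∷ z) → i ∷ z ≡ alt (suc (length z)) (not d)} d
          (λ red eq → ⊥-elim (descent red eq)) (λ red _ → reduced-alt red) i red eq
          where
          descent : Reduced (d ∷ z) → w ⁻¹ ≈ ev (d ∷ z) → ⊥
          descent red eq with () ← trans (sym asc) (trans (ν-congˡ eq) (reduced-first red))

      reverse-alt-+ : ∀ k j d → reverse (alt (k + j) d) ≡ reverse (alt j (flips k d)) ++ reverse (alt k d)
      reverse-alt-+ k j d = trans (cong reverse (alt-+ k j d)) (List.reverse-++ (alt k d) _)

      length-alt : ∀ k d → length (alt k d) ≡ k
      length-alt zero    d = refl
      length-alt (suc k) d = cong suc (length-alt k (not d))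

      -- Both elements are alternating words in a and b ending in the generator
      -- other than d.
      common-suffix : ∀ {u v} d → u ∈ H → v ∈ H → ν (u ⁻¹) (g d) ≡ false → ν (v ⁻¹) (g d) ≡ false → ℓ u < ℓ v →
        ∃[ z₁ ] ∃[ z ] (1 ≤ length z₁ × Reduced (z₁ ++ z) × u ≈ ev z × v ≈ ev (z₁ ++ z))
      common-suffix {u} {v} d uH vH νu νv lt with alt-ending d uH νu | alt-ending d vH νv
      ... | k , redu , equ | l , redv , eqv with ℕ.<-≤-connex k l
      ...   | inj₁ k<l with ℕ.m≤n⇒∃[o]m+o≡n k<l
      ...     | j , refl = reverse (alt (suc j) (flips k (not d))) , reverse (alt k (not d)) ,
        subst (1 ≤_) (sym (trans (List.length-reverse (alt (suc j) (flips k (not d)))) (length-alt (suc j) _))) (s≤s z≤n) ,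
        subst Reduced split redv , equ , subst (λ z → v ≈ ev z) split eqv
        where
        split : reverse (alt (suc k + j) (not d)) ≡ reverse (alt (suc j) (flips k (not d))) ++ reverse (alt k (not d))
        split = trans (cong (λ m → reverse (alt m (not d))) (sym (ℕ.+-suc k j))) (reverse-alt-+ k (suc j) (not d))
      -- In this case v would be a suffix of u, against `ℓ u < ℓ v`.
      common-suffix {u} {v} d uH vH νu νv lt | k , redu , equ | l , redv , eqv | inj₂ l≤k with ℕ.m≤n⇒∃[o]m+o≡n l≤k
      ...     | j , refl = ⊥-elim (ℕ.<⇒≱ lt (subst₂ _≤_ (ℓ-cong (≈-sym eqv)) (ℓ-cong (≈-sym (subst (λ z → u ≈ ev z) split equ)))
        (suffix-ℓ≤ (reverse (alt j (flips l (not d)))) (reverse (alt l (not d))) (subst Reduced split redu))))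
        where
        split = reverse-alt-+ l j (not d)

      shape-interior : ∀ {t w x} → t ∈ X → t ∈ H → w ∈ H → Bottom H x → Shape t w →
        ∃[ z ] (w ∙ x ⊏ z × z ⊏ t ∙ w ∙ x)
      shape-interior {t} {w} {x} tX tH wH bot (weak (d ∷ z₁) z w≈ tw≈ red (s≤s long) t≉g) =
        ev (z₁ ++ z) ∙ x ,
        ⊏-resp (∙-congʳ (≈-sym w≈)) ≈-refl (suffix⊏ gX bot z₁ z long (reduced-suffix (d ∷ []) red)) ,
        ⊏-resp ≈-refl (∙-congʳ (≈-sym tw≈)) (letter⊏ (z₁ ++ z) (gX d) bot red)
        where
        gX = generators∈X tX tH t≉g
      shape-interior {t} {w} {x} tX tH wH bot (switch d asc desc νw t≉r)
        with common-suffix {w} {t ∙ w ∙ g d} d wH (∙∈ (∙∈ tH wH) (g∈H d)) asc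
               (trans (right-descent-flips (g∈T d) (t ∙ w)) (cong not desc)) w<twd
        where
        w<wd : ℓ w < ℓ (w ∙ g d)
        w<wd = ascend (T-↑ (w ⁻¹) (g∈T d)) (≈-sym (↑⁻¹-∙ˡ (g d) w)) (trans (sym (ν-⁻¹ w (g d))) asc)
        -- Passing from w to `w ∙ g d` changes the inversions in H only at `g d ↑ w ⁻¹`, which is
        -- not t.
        νwd : ν (w ∙ g d) t ≡ false
        νwd with ν (w ∙ g d) t in eq
        ... | false = refl
        ... | true  = ⊥-elim (t≉r (↑-move (g-canonical d _ (↑∈ wH tH)
          (trans (cong (_xor ν (g d) (t ↑ w)) (sym νw)) (trans (sym (ν-∙ w (g d) t)) eq)))))
        w<twd : ℓ w < ℓ (t ∙ w ∙ g d)
        w<twd = ℕ.<-trans w<wd (ascend (⊆T tX) (assoc t w (g d)) νwd)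
      ... | z₁ , z , nonempty , red , w≈ , v≈ = [ bottom-switch , top-switch ]′ (inversion∈X tX tH rH (λ eq → t≉r (≈-sym eq)) νr)
        where
        tT = ⊆T tX
        r v : Carrier
        r = g d ↑ w ⁻¹
        v = t ∙ w ∙ g d
        rH : r ∈ H
        rH = ↑⁻¹∈ wH (g∈H d)
        νr : ν t r ≡ true
        νr = switch-inversion {w = w} {d} tT asc desc
        gX : ∀ d → g d ∈ X
        gX = generators∈X tX tH λ d′ eq → t≉r (≈-trans eq (≈-sym (g-canonical d′ r rH (trans (ν-congˡ (≈-sym eq)) νr))))
        asc-v : ν (v ⁻¹) (g d) ≡ false
        asc-v = trans (right-descent-flips (g∈T d) (t ∙ w)) (cong not desc)
        red′ : Reduced (z₁ ++ z ∷ʳ d)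
        red′ = subst Reduced (List.++-assoc z₁ z (d ∷ [])) (∷ʳ-reduced red (trans (ν-congˡ (⁻¹-cong (≈-sym v≈))) asc-v))
        -- Apply r to w first. Appending d to the words of w and v gives words of `w ∙ g d` and
        -- `t ∙ w`, so left weak moves do the rest.
        bottom-switch : r ∈ X → ∃[ z ] (w ∙ x ⊏ z × z ⊏ t ∙ w ∙ x)
        bottom-switch rX = w ∙ g d ∙ x ,
          ascent⊏ rX (≈-trans (∙-congʳ (≈-sym (↑⁻¹-∙ˡ (g d) w))) (assoc r w x))
            (trans (ν-coset bot wH rH) (trans (sym (ν-⁻¹ w (g d))) asc)) ,
          ⊏-resp
            (∙-congʳ (≈-trans (ev-∷ʳ z d) (∙-congʳ (≈-sym w≈))))
            (∙-congʳ (begin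
              ev (z₁ ++ z ∷ʳ d)       ≡⟨ cong ev (List.++-assoc z₁ z (d ∷ [])) ⟨
              ev ((z₁ ++ z) ∷ʳ d)     ≈⟨ ev-∷ʳ (z₁ ++ z) d ⟩
              ev (z₁ ++ z) ∙ g d      ≈⟨ ∙-congʳ v≈ ⟨
              t ∙ w ∙ g d ∙ g d       ≈⟨ solve (free (t ∙ w) ∷ invol (g² d) ∷ []) (x₀ ⊙ x₁ ⊙ x₁) x₀ refl ⟩
              t ∙ w                   ∎))
            (suffix⊏ gX bot z₁ (z ∷ʳ d) nonempty red′)
        -- Climb from w to v by left weak moves; then `r ↑ t` carries v to `t ∙ w`.
        top-switch : r ↑ t ∈ X → ∃[ z ] (w ∙ x ⊏ z × z ⊏ t ∙ w ∙ x)
        top-switch rX = v ∙ x ,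
          ⊏-resp (∙-congʳ (≈-sym w≈)) (∙-congʳ (≈-sym v≈)) (suffix⊏ gX bot z₁ z nonempty red) ,
          ascent⊏ rX
            (solve (invol (T-involutive tT) ∷ free w ∷ invol (g² d) ∷ free x ∷ [])
              (x₀ ⊙ x₁ ⊙ x₃) (x₀ ⁻ ⊙ (x₁ ⁻ ⁻ ⊙ x₂ ⊙ x₁ ⁻) ⊙ x₀ ⊙ (x₀ ⊙ x₁ ⊙ x₂ ⊙ x₃)) refl)
            (trans (ν-coset bot (∙∈ (∙∈ tH wH) (g∈H d)) (↑∈ tH rH)) (trans (ν-congʳ
              (solve (invol (T-involutive tT) ∷ free w ∷ invol (g² d) ∷ [])
                (x₀ ⁻ ⊙ (x₁ ⁻ ⁻ ⊙ x₂ ⊙ x₁ ⁻) ⊙ x₀) ((x₀ ⊙ x₁ ⊙ x₂) ⁻ ⁻ ⊙ x₂ ⊙ (x₀ ⊙ x₁ ⊙ x₂) ⁻) refl))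
              (trans (sym (ν-⁻¹ v (g d))) asc-v)))

    gap-interior : ∀ {t u} → t ∈ X → Gap t u → ∃[ z ] (u ⊏ z × z ⊏ t ∙ u)
    gap-interior {t} tX G with shape-interior pair tX t∈H w∈H bottom shape
      where open Gap G
    ... | z , lower , upper = z , ⊏-resp (≈-sym u≈wx) ≈-refl lower ,
      ⊏-resp ≈-refl (≈-trans (assoc t w x) (∙-congˡ (≈-sym u≈wx))) upper
      where open Gap G

    -- Containment of X in the parabolic subgroup W_J.

    J : Pred (Fin n) p
    J = S∩ X

    -- A simple left descent s of t is canonical in every reflection subgroup containing it. Unless
    -- t = s, the palindrome of t in the dihedral subgroup of s and t can be taken to begin and end
    -- with s; then s lies in X as a suffix, and the core is a shorter reflection in X.
    X⊆Parabolic : ∀ {t} → t ∈ X → ¬ ¬ (t ∈ Parabolic J)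
    X⊆Parabolic {t} = go (suc (ℓ t)) t ℕ.≤-refl
      where
      Goal : Carrier → Set (c ⊔ e ⊔ p)
      Goal t = t ∈ Parabolic J
      simple : ∀ {t i} → s i ≈ t → t ∈ X → Goal t
      simple {i = i} eq tX = incl (i , X-resp ideal (≈-sym eq) tX , ≈-sym eq)
      go : ∀ k t → ℓ t < k → t ∈ X → ¬ ¬ Goal t
      go (suc k) t (s≤s t≤k) tX with left-descent-exists t (λ eq → ε∉T (T-resp eq (⊆T tX)))
      ... | i , νt with s i ≈? t
      ...   | yes eq = return (simple eq tX)
      ...   | no s≉t = canonicalPair (s∈T i) (⊆T tX) s≉t >>= λ (a , b , P , s∈H , t∈H) → peel P s∈H t∈H
        where
        module _ {a b} (P : CanonicalPair a b) where
          open Dihedral P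
          open Ideal ideal
          peel : s i ∈ H → t ∈ H → ¬ ¬ Goal t
          peel s∈H t∈H with canonical-cases (s∈T i) s∈H (λ p _ → s-canonical i p)
          ... | d , s≈ with palindrome-from d (⊆T tX) t∈H (trans (ν-congʳ (≈-sym s≈)) νt)
          ...   | zero , _ , eq = ⊥-elim (s≉t (≈-trans s≈ (≈-sym (≈-trans eq (identityʳ _)))))
          ...   | suc h , red , eq = go k core (ℕ.<-≤-trans shorter t≤k) (pal-core∈X {h} red pX) >>= λ core∈ →
            return (resp (≈-sym t≈) (mult (mult s∈ core∈) s∈))
            where
            core = ev (pal h (not d))
            pX : ev (pal (suc h) d) ∈ X
            pX = X-resp ideal eq tX
            s∈ : Goal (s i)
            s∈ = incl (i , X-resp ideal (≈-trans (identityʳ _) (≈-sym s≈)) (pal-suffix∈X {0} {suc h} z≤n red pX) , ≈-refl)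
            t≈ : t ≈ s i ∙ core ∙ s i
            t≈ = begin
              t                     ≈⟨ eq ⟩
              ev (pal (suc h) d)    ≈⟨ ev-pal-suc h d ⟩
              core ↑ g d            ≈⟨ ∙-congʳ (∙-congʳ (T-⁻¹ (g∈T d))) ⟩
              g d ∙ core ∙ g d      ≈⟨ ∙-cong (∙-congʳ s≈) s≈ ⟨
              s i ∙ core ∙ s i      ∎
            red′ : Reduced (d ∷ pal h (not d) ∷ʳ d)
            red′ = subst Reduced (pal-suc h d) red
            shorter : ℓ core < ℓ t
            shorter = ℕ.<-trans
              (ascend (T-↑ (core ⁻¹) (g∈T d)) (≈-sym (↑⁻¹-∙ˡ (g d) core))
                (trans (sym (ν-⁻¹ core (g d))) (reduced-∷ʳ {z = pal h (not d)} (reduced-suffix (d ∷ []) red′))))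
              (ascend (g∈T d)
                (begin
                  t                             ≈⟨ eq ⟩
                  ev (pal (suc h) d)            ≡⟨ cong ev (pal-suc h d) ⟩
                  g d ∙ ev (pal h (not d) ∷ʳ d) ≈⟨ ∙-congˡ (ev-∷ʳ (pal h (not d)) d) ⟩
                  g d ∙ (core ∙ g d)            ∎)
                (trans (ν-congˡ (≈-sym (ev-∷ʳ (pal h (not d)) d))) (reduced-ascent red′)))

  -- Shortest elements of parabolic cosets.

  module ParabolicSubgroup {p} (J : Pred (Fin n) p) where

    private
      W_J-sub = ⟨⟩-isSubgroup (λ w → ∃[ i ] (i ∈ J × w ≈ s i))

    open Cosets W_J-sub
    open Words {I = ∃[ i ] i ∈ J} (λ (i , _) → s i) W_J-sub (λ (i , _) → s∈T i)
      (λ (i , iJ) → incl (i , iJ , ≈-refl)) (λ (i , _) q _ → s-canonical i q)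

    bottom-shortest : ∀ {x} → Bottom (Parabolic J) x → ∀ z → Reduced z → ℓ x ≤ ℓ (ev z ∙ x)
    bottom-shortest bot []            red = ℕ.≤-reflexive (ℓ-cong (≈-sym (identityˡ _)))
    bottom-shortest {x} bot ((i , iJ) ∷ z) red = ℕ.≤-trans (bottom-shortest bot z (reduced-suffix ((i , iJ) ∷ []) red))
      (ℕ.<⇒≤ (subst (ℓ (ev z ∙ x) <_) (ℓ-cong (≈-sym (assoc (s i) (ev z) x)))
        (ν-false (s∈T i) (trans (ν-coset bot (ev∈H z) (incl (i , iJ , ≈-refl))) (reduced-ascent red)))))

    -- Write q = w x with x shortest in the coset. The first letter of a nonempty reduced word of w
    -- would be a left descent of q in J, so q = x.
    minimalCosetRep-shortest : ∀ {q b} → q ∈ MinimalCosetRep J → b ∈ Parabolic J → ℓ q ≤ ℓ (b ∙ q)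
    minimalCosetRep-shortest {q} {b} minRep b∈ = decidable-stable (ℓ q ℕ.≤? ℓ (b ∙ q)) (
      bottom-exists q >>= λ (x , w , w∈ , q≈wx , bot) → return (compare w∈ q≈wx bot))
      where
      letter : ∀ {w} → ∃[ i ] (i ∈ J × w ≈ s i) → Σ (∃[ i ] i ∈ J) λ (i , _) → w ≈ s i
      letter (i , iJ , eq) = (i , iJ) , eq
      compare : ∀ {x w} → w ∈ Parabolic J → q ≈ w ∙ x → Bottom (Parabolic J) x → ℓ q ≤ ℓ (b ∙ q)
      compare {x} {w} w∈ q≈wx bot with reducedWord letter w∈ | reducedWord letter b∈
      ... | (i , iJ) ∷ z , red , w≈ | _ with () ← trans (sym (<⇒ν-false (minRep i iJ)))
        (trans (ν-congˡ q≈wx) (trans (ν-coset bot w∈ (incl (i , iJ , ≈-refl))) (trans (ν-congˡ w≈) (reduced-first red))))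
      ... | [] , _ , w≈ | z , red , b≈ = subst₂ _≤_ (ℓ-cong (≈-sym q≈x)) (ℓ-cong (∙-cong (≈-sym b≈) (≈-sym q≈x)))
        (bottom-shortest bot z red)
        where
        q≈x : q ≈ x
        q≈x = ≈-trans q≈wx (≈-trans (∙-congʳ w≈) (identityˡ x))

theorem3p4 : ∀ {c e p : Level}
    (𝒲 : CoxeterSystem c e) (len : LengthFunction 𝒲)
    (let open CoxeterSystem 𝒲 using (Carrier))
    (let open Coxeter 𝒲 len)
    (X : Pred Carrier p) → IsOrderIdeal X →
    (π : ParabolicProjection (S∩ X)) →
    IsGradedBy (LPoset X) (rank π)
theorem3p4 𝒲 len X ideal π = record { minimal-rank = minimal-rank ; cover-rank = cover-rank }
  where
  open OrderIdeals 𝒲 len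
  open OrderIdeal ideal hiding (J)
  open ParabolicSubgroup (S∩ X)
  open ParabolicProjection π
  open IsOrderIdeal ideal

  ⊏⇒strict : ∀ {u v} → u ⊏ v → LOrder X u v × ¬ u ≈ v
  ⊏⇒strict p = inj₂ p , <⇒≉ (proj₁ p)

  step⊏ : ∀ {u v} → LStep X u v → u ⊏ v
  step⊏ st@(_ , _ , _ , u<v) = bruhat u<v , [ st ]
    where
    chain : ∀ {u v} → TransClosure BruhatStep u v → ℓ u < ℓ v
    chain [ _ , _ , _ , lt ]      = lt
    chain ((_ , _ , _ , lt) ∷ xs) = ℕ.<-trans lt (chain xs)
    bruhat : ∀ {u v} → u <ᴮ v → ℓ u < ℓ v
    bruhat (inj₁ eq , ne) = ⊥-elim (ne eq)
    bruhat (inj₂ xs , _)  = chain xs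

  chain⊏ : ∀ {u v} → TransClosure (LStep X) u v → u ⊏ v
  chain⊏ [ st ]    = step⊏ st
  chain⊏ (st ∷ xs) = ⊏-trans (step⊏ st) (chain⊏ xs)

  -- A left descent of u in J would give an element below u. Without one, u is shortest in W_J u,
  -- hence no longer than `Q u`.
  minimal-rank : ∀ u → Minimal (LPoset X) u → rank π u ≡ 0
  minimal-rank u min with factors u
  ... | a , a∈ , u≈ , _ = ℕ.m≤n⇒m∸n≡0 (subst (ℓ u ≤_) (ℓ-cong (begin
      a ⁻¹ ∙ u          ≈⟨ ∙-congˡ u≈ ⟩
      a ⁻¹ ∙ (a ∙ Q u)  ≈⟨ solve (free a ∷ free (Q u) ∷ []) (x₀ ⁻ ⊙ (x₀ ⊙ x₁)) x₁ refl ⟩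
      Q u               ∎)) (minimalCosetRep-shortest minRep-u (inv a∈)))
    where
    minRep-u : u ∈ MinimalCosetRep (S∩ X)
    minRep-u i i∈ with ν u (s i) in νu
    ... | false = ν-false (s∈T i) νu
    ... | true  = ⊥-elim (min (s i ∙ u) (⊏⇒strict (ascent⊏ i∈
      (solve (invol (s-involutive i) ∷ free u ∷ []) x₁ (x₀ ⊙ (x₀ ⊙ x₁)) refl)
      (<⇒ν-false (subst (ℓ (s i ∙ u) <_) (ℓ-cong
        (solve (invol (s-involutive i) ∷ free u ∷ []) x₁ (x₀ ⊙ (x₀ ⊙ x₁)) refl)) (ν-true νu))))))

  -- `Q u` and `Q v` are shortest in the same coset of W_J; comparing lengths avoids any appeal to
  -- uniqueness of representatives.
  Q-invariant : ∀ {t u v} → t ∈ X → v ≈ t ∙ u → ℓ (Q v) ≡ ℓ (Q u)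
  Q-invariant {t} {u} {v} tX v≈ = decidable-stable (_ ℕ.≟ _) (X⊆Parabolic tX >>= λ t∈ → return (equal t∈))
    where
    equal : t ∈ Parabolic (S∩ X) → ℓ (Q v) ≡ ℓ (Q u)
    equal t∈ with factors u | factors v
    ... | a , a∈ , u≈ , _ | b , b∈ , v≈′ , _ = ℕ.≤-antisym
      (subst (ℓ (Q v) ≤_) (ℓ-cong (begin
        k ⁻¹ ∙ Q v       ≈⟨ ∙-congˡ Qv≈ ⟩
        k ⁻¹ ∙ (k ∙ Q u) ≈⟨ solve (free k ∷ free (Q u) ∷ []) (x₀ ⁻ ⊙ (x₀ ⊙ x₁)) x₁ refl ⟩
        Q u              ∎)) (minimalCosetRep-shortest (minRep v) (inv k∈)))
      (subst (ℓ (Q u) ≤_) (ℓ-cong (≈-sym Qv≈)) (minimalCosetRep-shortest (minRep u) k∈))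
      where
      k = b ⁻¹ ∙ t ∙ a
      k∈ : k ∈ Parabolic (S∩ X)
      k∈ = mult (mult (inv b∈) t∈) a∈
      Qv≈ : Q v ≈ k ∙ Q u
      Qv≈ = begin
        Q v                    ≈⟨ solve (free b ∷ free (Q v) ∷ []) x₁ (x₀ ⁻ ⊙ (x₀ ⊙ x₁)) refl ⟩
        b ⁻¹ ∙ (b ∙ Q v)       ≈⟨ ∙-congˡ v≈′ ⟨
        b ⁻¹ ∙ v               ≈⟨ ∙-congˡ (≈-trans v≈ (∙-congˡ u≈)) ⟩
        b ⁻¹ ∙ (t ∙ (a ∙ Q u)) ≈⟨ solve (free b ∷ free t ∷ free a ∷ free (Q u) ∷ []) (x₀ ⁻ ⊙ (x₁ ⊙ (x₂ ⊙ x₃))) (x₀ ⁻ ⊙ x₁ ⊙ x₂ ⊙ x₃) refl ⟩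
        k ∙ Q u                ∎

  -- Each step of a chain is already a strict relation, so a chain with more than one step exposes
  -- an element strictly between.
  cover-step : ∀ {u v} → Covers (LPoset X) v u → LStep X u v
  cover-step ((inj₁ eq , ne) , _) = ⊥-elim (ne eq)
  cover-step ((inj₂ (_ , [ st ]) , _) , _) = st
  cover-step ((inj₂ (_ , st ∷ xs) , _) , none) = ⊥-elim (none _ (⊏⇒strict (step⊏ st) , ⊏⇒strict (chain⊏ xs)))

  cover-ℓ : ∀ {u v} → Covers (LPoset X) v u → ℓ v ≡ suc (ℓ u)
  cover-ℓ {u} {v} cov with cover-step cov
  ... | st@(t , tX , v≈ , _) = decidable-stable (ℓ v ℕ.≟ suc (ℓ u)) λ ne →
    -- The step raises the length, so failing to raise it by exactly one leaves a gap of at least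
    -- two.
    gap-exists (⊆T tX) u (subst (2 + ℓ u ≤_) (ℓ-cong v≈) (ℕ.≤∧≢⇒< (proj₁ (step⊏ st)) (λ eq → ne (sym eq)))) λ G →
    between (gap-interior tX G)
    where
    between : ∃[ z ] (u ⊏ z × z ⊏ t ∙ u) → ⊥
    between (z , lower , upper) = proj₂ cov z (⊏⇒strict lower , ⊏⇒strict (⊏-resp ≈-refl (≈-sym v≈) upper))

  Q-ℓ≤ : ∀ u → ℓ (Q u) ≤ ℓ u
  Q-ℓ≤ u with factors u
  ... | a , _ , _ , ℓ≡ = subst (ℓ (Q u) ≤_) (sym ℓ≡) (ℕ.m≤n+m _ (ℓ a))

  cover-rank : ∀ u v → Covers (LPoset X) v u → rank π v ≡ suc (rank π u)
  cover-rank u v cov with cover-step cov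
  -- `Q-ℓ≤` lets the successor move out of the truncated subtraction.
  ... | t , tX , v≈ , _ = trans (cong₂ _∸_ (cover-ℓ cov) (Q-invariant tX v≈)) (ℕ.+-∸-assoc 1 (Q-ℓ≤ u))
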